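{- Let $\mathcal{M}$ be a countable model of $\mathsf{PA}$ and let $J$ be a cut of $\mathcal{M}$. The following are equivalent: (1) $J$ is exponentially closed; (2) there is $\mathcal{N}\succ\mathcal{M}$ such that $\mathrm{gcis}(\mathcal{M},\mathcal{N})=J$ and $\mathrm{cod}(\mathcal{N}/J)=\mathrm{cod}(\mathcal{M}/J)$; (3) $\mathcal{M}$ has a minimal elementary extension $\mathcal{N}$ such that $\mathrm{gcis}(\mathcal{M},\mathcal{N})=J$, $\mathrm{cod}(\mathcal{N}/J)=\mathrm{cod}(\mathcal{M}/J)$, and $\mathcal{N}$ does not fill $J$.
   Context: Models are models of $\mathsf{PA}$ in the language $\{+,\times,0,1,\leq\}$; $\mathcal{M}\prec\mathcal{N}$ means proper elementary extension. $\mathrm{Def}(\mathcal{M})$ is the set of parametrically definable subsets of $M$. A cut of $\mathcal{M}$ is a set $J\subseteq M$ with $0\in J\neq M$ such that whenever $a\leq b\in J$ then $a+1\in J$; it is exponentially closed if $2^a\in J$ whenever $a\in J$. $\mathrm{cod}(\mathcal{M}/J)=\{A\cap J:A\in\mathrm{Def}(\mathcal{M})\}$. For $\mathcal{M}\prec\mathcal{N}$, $\mathrm{gcis}(\mathcal{M},\mathcal{N})=\{b\in M:\text{whenever }\mathcal{N}\models a\leq b\text{ then }a\in M\}$. $\mathcal{N}$ fills $J$ if some $b\in N$ satisfies $\mathcal{N}\models a<b<c$ for all $a\in J$, $c\in M\setminus J$. A minimal elementary extension $\mathcal{N}\succ\mathcal{M}$ is one with no $\mathcal{K}$ satisfying $\mathcal{M}\prec\mathcal{K}\prec\mathcal{N}$.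 -}

module Defs where

open import Level using (Level; 0ℓ) renaming (suc to lsuc)
open import Data.Nat using (ℕ; zero; suc)
open import Data.Fin using (Fin)
open import Data.Vec.Functional using (_∷_)
open import Data.Product using (Σ; Σ-syntax; _×_; _,_)
open import Data.Empty using (⊥)
open import Relation.Nullary using (¬_)
open import Relation.Binary.PropositionalEquality using (_≡_; _≢_)
open import Function using (_∘_)

-- First-order syntax of the language {+, ×, 0, 1, ≤} (with equality).
-- Formulas with n free variables (de Bruijn: variable 0 is the most
-- recently bound / first in the environment).

infixl 6 _`+_
infixl 7 _`*_

data Term (n : ℕ) : Set where
  var   : Fin n → Term n
  `0 `1 : Term n
  _`+_  : Term n → Term n → Term n
  _`*_  : Term n → Term n → Term n

data Formula (n : ℕ) : Set where
  _≐_ : Term n → Term n → Formula n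
  _≼_ : Term n → Term n → Formula n
  ⊥'  : Formula n
  _⇒_ : Formula n → Formula n → Formula n
  ∀'  : Formula (suc n) → Formula n

record Structure : Set₁ where
  infixl 6 _+_
  infixl 7 _*_
  infix 4 _≤_
  field
    Carrier : Set
    𝟎 𝟏     : Carrier
    _+_ _*_ : Carrier → Carrier → Carrier
    _≤_     : Carrier → Carrier → Set

open Structure public using (Carrier)

_⊨_<_ : (M : Structure) → Carrier M → Carrier M → Set
M ⊨ a < b = Structure._≤_ M a b × a ≢ b

eval : (M : Structure) {n : ℕ} → Term n → (Fin n → Carrier M) → Carrier M
eval M (var i)   ρ = ρ i
eval M `0        ρ = Structure.𝟎 M
eval M `1        ρ = Structure.𝟏 M
eval M (s `+ t)  ρ = Structure._+_ M (eval M s ρ) (eval M t ρ)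
eval M (s `* t)  ρ = Structure._*_ M (eval M s ρ) (eval M t ρ)

Sat : (M : Structure) {n : ℕ} → Formula n → (Fin n → Carrier M) → Set
Sat M (s ≐ t) ρ = eval M s ρ ≡ eval M t ρ
Sat M (s ≼ t) ρ = Structure._≤_ M (eval M s ρ) (eval M t ρ)
Sat M ⊥'      ρ = ⊥
Sat M (φ ⇒ ψ) ρ = Sat M φ ρ → Sat M ψ ρ
Sat M (∀' φ)  ρ = (a : Carrier M) → Sat M φ (a ∷ ρ)

-- Models of PA: the axioms of PA (in the language with ≤), with each
-- sentence written out as what its satisfaction in M unfolds to.
-- The induction schema is the universal closure of
--   φ(0,ȳ) ∧ ∀x (φ(x,ȳ) → φ(x+1,ȳ)) → ∀x φ(x,ȳ)   for every formula φ.

record IsPA (M : Structure) : Set₁ where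
  open Structure M hiding (Carrier)
  C = Structure.Carrier M
  field
    succ≢0    : ∀ x → x + 𝟏 ≢ 𝟎
    succ-inj  : ∀ x y → x + 𝟏 ≡ y + 𝟏 → x ≡ y
    +-0       : ∀ x → x + 𝟎 ≡ x
    +-succ    : ∀ x y → x + (y + 𝟏) ≡ (x + y) + 𝟏
    *-0       : ∀ x → x * 𝟎 ≡ 𝟎
    *-succ    : ∀ x y → x * (y + 𝟏) ≡ x * y + x
    ≤-def     : ∀ x y → (x ≤ y → Σ[ z ∈ C ] x + z ≡ y)
                      × ((Σ[ z ∈ C ] x + z ≡ y) → x ≤ y)
    induction : ∀ {n} (φ : Formula (suc n)) (ρ : Fin n → C) →
                Sat M φ (𝟎 ∷ ρ) →
                (∀ x → Sat M φ (x ∷ ρ) → Sat M φ ((x + 𝟏) ∷ ρ)) →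
                ∀ x → Sat M φ (x ∷ ρ)

Countable : Structure → Set
Countable M = Σ[ e ∈ (ℕ → Carrier M) ] (∀ m → Σ[ k ∈ ℕ ] e k ≡ m)

record ElemEmb (M N : Structure) : Set where
  field
    emb  : Carrier M → Carrier N
    elem : ∀ {n} (φ : Formula n) (ρ : Fin n → Carrier M) →
           (Sat M φ ρ → Sat N φ (emb ∘ ρ)) × (Sat N φ (emb ∘ ρ) → Sat M φ ρ)

open ElemEmb public

Proper : {M N : Structure} → ElemEmb M N → Set
Proper {M} {N} f = Σ[ b ∈ Carrier N ] (∀ a → emb f a ≢ b)

Minimal : {M N : Structure} → ElemEmb M N → Set₁
Minimal {M} {N} f =
  Proper f ×
  ¬ (Σ[ K ∈ Structure ] Σ[ g ∈ ElemEmb M K ] Σ[ h ∈ ElemEmb K N ]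
       (Proper g × Proper h × (∀ a → emb h (emb g a) ≡ emb f a)))

Pred : Structure → Set₁
Pred M = Carrier M → Set

record IsCut (M : Structure) (J : Pred M) : Set where
  open Structure M hiding (Carrier)
  field
    zero∈  : J 𝟎
    ≠M     : Σ[ c ∈ Carrier M ] ¬ J c
    closed : ∀ a b → a ≤ b → J b → J (a + 𝟏)

-- Exponentiation in a model of PA, via its standard arithmetical
-- definition using Gödel's β-function:
--   y = 2^x  iff  ∃ c d ( β(c,d,0) = 1 ∧ ∀ i < x  β(c,d,i+1) = 2·β(c,d,i)
--                          ∧ β(c,d,x) = y ),
-- where β(c,d,i) = c mod (1 + (i+1)·d).
Rem : (M : Structure) → Carrier M → Carrier M → Carrier M → Set
Rem M a m r = Σ[ q ∈ Carrier M ] (a ≡ Structure._+_ M (Structure._*_ M q m) r) × (M ⊨ r < m)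

β≡ : (M : Structure) → Carrier M → Carrier M → Carrier M → Carrier M → Set
β≡ M c d i u = Rem M c (Structure._+_ M (Structure.𝟏 M) (Structure._*_ M (Structure._+_ M i (Structure.𝟏 M)) d)) u

Exp≡ : (M : Structure) → Carrier M → Carrier M → Set
Exp≡ M x y = Σ[ c ∈ Carrier M ] Σ[ d ∈ Carrier M ]
  β≡ M c d (Structure.𝟎 M) (Structure.𝟏 M) ×
  (∀ i → M ⊨ i < x → ∀ u → β≡ M c d i u → β≡ M c d (Structure._+_ M i (Structure.𝟏 M)) (Structure._+_ M u u)) ×
  β≡ M c d x y

ExpClosed : (M : Structure) → Pred M → Set
ExpClosed M J = ∀ a → J a → Σ[ y ∈ Carrier M ] Exp≡ M a y × J y

GcisIs : {M N : Structure} → ElemEmb M N → Pred M → Set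
GcisIs {M} {N} f J =
  ∀ b → (J b → ∀ a → Structure._≤_ N a (emb f b) → Σ[ c ∈ Carrier M ] emb f c ≡ a)
      × ((∀ a → Structure._≤_ N a (emb f b) → Σ[ c ∈ Carrier M ] emb f c ≡ a) → J b)

-- Sets X ⊆ J are represented by predicates on M, considered only on J.
-- X ∈ cod(M/J): X = A ∩ J for some parametrically definable A ⊆ M.
CodM : (M : Structure) → Pred M → Pred M → Set
CodM M J X = Σ[ n ∈ ℕ ] Σ[ φ ∈ Formula (suc n) ] Σ[ ρ ∈ (Fin n → Carrier M) ]
  (∀ a → J a → (X a → Sat M φ (a ∷ ρ)) × (Sat M φ (a ∷ ρ) → X a))

CodN : {M N : Structure} → ElemEmb M N → Pred M → Pred M → Set
CodN {M} {N} f J X = Σ[ n ∈ ℕ ] Σ[ φ ∈ Formula (suc n) ] Σ[ ρ ∈ (Fin n → Carrier N) ]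
  (∀ a → J a → (X a → Sat N φ (emb f a ∷ ρ)) × (Sat N φ (emb f a ∷ ρ) → X a))

SameCod : {M N : Structure} → ElemEmb M N → Pred M → Set₁
SameCod {M} f J = ∀ (X : Pred M) → (CodN f J X → CodM M J X) × (CodM M J X → CodN f J X)

Fills : {M N : Structure} → ElemEmb M N → Pred M → Set
Fills {M} {N} f J = Σ[ b ∈ Carrier N ]
  (∀ a → J a → N ⊨ emb f a < b) × (∀ c → ¬ J c → N ⊨ b < emb f c)

{-# OPTIONS --safe #-}
module Submission where

-- If N has the properties in (2) and a ∈ J but 2^a ∉ J, then N has a new element b < 2^a.  The binary
-- digits of b form a subset of [0, a) ⊆ J that is coded in M, hence they are the digits of an element
-- of M, which has to be b.
--
-- Conversely, let J be exponentially closed.  Call an M-finite set large if its cardinality is not in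
-- J.  By the pigeonhole principle, given a large set A and a definable f, there is a large subset of A
-- on which f is constant, or injective with all values above some r ∉ J.  Overspill gives a ∉ J with
-- 2^a · 2^a < |A|; so, given a definable relation φ(y, x), one of the 2^a possible sets
-- {y < a : φ(y, x)} is attained by all x in a large subset of A.  As M is countable, all these
-- requirements can be met along a descending chain of large sets, which are moreover eventually of
-- size at most c for every c ∉ J.  The chain generates an ultrafilter on the definable sets, and N is
-- the corresponding ultrapower by definable functions: injectivity gives minimality, the sizes
-- determine gcis(M, N), and the constant sets {y < a : φ(y, x)} give cod(N/J) = cod(M/J).

open import Defs
open import Level using (Level; 0ℓ)
open import Data.Nat as ℕ using (ℕ; zero; suc; pred; _⊔_)
import Data.Nat.Properties as ℕₚ
open import Data.Fin using (Fin; zero; suc; toℕ; fromℕ<)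
open import Data.Fin.Properties using (toℕ-fromℕ<)
open import Data.Vec.Functional using (_∷_; [])
open import Data.Product using (Σ; Σ-syntax; _×_; _,_; proj₁; proj₂)
open import Data.Sum using (_⊎_; inj₁; inj₂; [_,_]′)
open import Data.Empty using (⊥; ⊥-elim)
open import Relation.Nullary using (¬_; Dec; yes; no)
open import Relation.Binary.PropositionalEquality
open import Function using (_∘_; id)
open import Axiom.ExcludedMiddle using (ExcludedMiddle)
open import Algebra.Bundles using (CommutativeSemiring)
open import Algebra.Structures.Biased using (isCommutativeSemiringʳ)
import Algebra.Solver.Ring.NaturalCoefficients.Default as Solver

-- Each thinning must leave a set whose size is still outside J. Splitting into w pieces costs a
-- factor w, so 2^a serves both as the number of pieces and as the size that is kept; this is why
-- the room asked for is 2^a · 2^a < |A| with a outside J. Exponential closure enters only there,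
-- through `small-exponent`.
--
-- Countability enters twice: it numbers the functions and relations definable with parameters, and
-- it lists the elements outside J by which the sizes are bounded. Only finitely many requirements
-- are met at each stage, and no set below the whole chain is ever formed.
--
-- Exponentiation in the statement is a formula about Gödel's β-function, and induction in M is
-- available only for formulas. Hence arithmetic up to the β-lemma is developed inside M, and a
-- statement proved by induction there is written as an `Fm`, whose interpretation is the Agda
-- statement itself.

infix 1 _⟺_
_⟺_ : ∀ {a b} → Set a → Set b → Set _
A ⟺ B = (A → B) × (B → A)

⟺-refl : ∀ {a} {A : Set a} → A ⟺ A
⟺-refl = id , id

⟺-sym : ∀ {a b} {A : Set a} {B : Set b} → A ⟺ B → B ⟺ A
⟺-sym (f , g) = g , f

⟺-trans : ∀ {a b c} {A : Set a} {B : Set b} {D : Set c} → A ⟺ B → B ⟺ D → A ⟺ D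
⟺-trans (f , g) (h , k) = h ∘ f , g ∘ k

⟺-→ : ∀ {A B A′ B′ : Set} → A ⟺ A′ → B ⟺ B′ → (A → B) ⟺ (A′ → B′)
⟺-→ (f , g) (h , k) = (λ p → h ∘ p ∘ g) , (λ p → k ∘ p ∘ f)

⟺-∀ : ∀ {C : Set} {P Q : C → Set} → (∀ c → P c ⟺ Q c) → (∀ c → P c) ⟺ (∀ c → Q c)
⟺-∀ h = (λ p c → proj₁ (h c) (p c)) , (λ p c → proj₂ (h c) (p c))

⟺-≡ : ∀ {A : Set} {a b a′ b′ : A} → a ≡ a′ → b ≡ b′ → (a ≡ b) ⟺ (a′ ≡ b′)
⟺-≡ refl refl = ⟺-refl

⟺-rel : ∀ {A : Set} (R : A → A → Set) {a b a′ b′ : A} → a ≡ a′ → b ≡ b′ → R a b ⟺ R a′ b′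
⟺-rel R refl refl = ⟺-refl

-- Raw formulas and infinite environments

-- Raw syntax: de Bruijn variables are unbounded, so that the parameters of a formula can be the
-- values of one fixed infinite environment.

infixl 6 _r+_
infixl 7 _r*_
infixr 5 _r⇒_

data RTerm : Set where
  rvar      : ℕ → RTerm
  r0 r1     : RTerm
  _r+_ _r*_ : RTerm → RTerm → RTerm

data RFormula : Set where
  _r≐_ _r≼_ : RTerm → RTerm → RFormula
  r⊥        : RFormula
  _r⇒_      : RFormula → RFormula → RFormula
  r∀        : RFormula → RFormula

infixr 5 _◂_
_◂_ : {A : Set} → A → (ℕ → A) → ℕ → A
(a ◂ ρ) zero    = a
(a ◂ ρ) (suc i) = ρ i

REval : (K : Structure) → RTerm → (ℕ → Carrier K) → Carrier K
REval K (rvar i) ρ = ρ i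
REval K r0       ρ = Structure.𝟎 K
REval K r1       ρ = Structure.𝟏 K
REval K (s r+ t) ρ = Structure._+_ K (REval K s ρ) (REval K t ρ)
REval K (s r* t) ρ = Structure._*_ K (REval K s ρ) (REval K t ρ)

RSat : (K : Structure) → RFormula → (ℕ → Carrier K) → Set
RSat K (s r≐ t) ρ = REval K s ρ ≡ REval K t ρ
RSat K (s r≼ t) ρ = Structure._≤_ K (REval K s ρ) (REval K t ρ)
RSat K r⊥       ρ = ⊥
RSat K (φ r⇒ ψ) ρ = RSat K φ ρ → RSat K ψ ρ
RSat K (r∀ φ)   ρ = (a : Carrier K) → RSat K φ (a ◂ ρ)

◂-cong : {A : Set} (a : A) {ρ ρ′ : ℕ → A} → ρ ≗ ρ′ → (a ◂ ρ) ≗ (a ◂ ρ′)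
◂-cong a h zero    = refl
◂-cong a h (suc i) = h i

lift : (ℕ → ℕ) → ℕ → ℕ
lift r = 0 ◂ (suc ∘ r)

renT : (ℕ → ℕ) → RTerm → RTerm
renT r (rvar i) = rvar (r i)
renT r r0       = r0
renT r r1       = r1
renT r (s r+ t) = renT r s r+ renT r t
renT r (s r* t) = renT r s r* renT r t

ren : (ℕ → ℕ) → RFormula → RFormula
ren r (s r≐ t) = renT r s r≐ renT r t
ren r (s r≼ t) = renT r s r≼ renT r t
ren r r⊥       = r⊥
ren r (φ r⇒ ψ) = ren r φ r⇒ ren r ψ
ren r (r∀ φ)   = r∀ (ren (lift r) φ)

module _ (K : Structure) where
  open Structure K using (_+_; _*_; _≤_)

  REval-cong : ∀ t {ρ ρ′} → ρ ≗ ρ′ → REval K t ρ ≡ REval K t ρ′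
  REval-cong (rvar i) h = h i
  REval-cong r0       h = refl
  REval-cong r1       h = refl
  REval-cong (s r+ t) h = cong₂ _+_ (REval-cong s h) (REval-cong t h)
  REval-cong (s r* t) h = cong₂ _*_ (REval-cong s h) (REval-cong t h)

  RSat-cong : ∀ φ {ρ ρ′} → ρ ≗ ρ′ → RSat K φ ρ ⟺ RSat K φ ρ′
  RSat-cong (s r≐ t) h = ⟺-≡ (REval-cong s h) (REval-cong t h)
  RSat-cong (s r≼ t) h = ⟺-rel _≤_ (REval-cong s h) (REval-cong t h)
  RSat-cong r⊥       h = ⟺-refl
  RSat-cong (φ r⇒ ψ) h = ⟺-→ (RSat-cong φ h) (RSat-cong ψ h)
  RSat-cong (r∀ φ)   h = ⟺-∀ (λ a → RSat-cong φ (◂-cong a h))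

  renT-eval : ∀ t {r ρ ρ′} → ρ ∘ r ≗ ρ′ → REval K (renT r t) ρ ≡ REval K t ρ′
  renT-eval (rvar i) h = h i
  renT-eval r0       h = refl
  renT-eval r1       h = refl
  renT-eval (s r+ t) h = cong₂ _+_ (renT-eval s h) (renT-eval t h)
  renT-eval (s r* t) h = cong₂ _*_ (renT-eval s h) (renT-eval t h)

  lift-◂ : ∀ a {r} {ρ ρ′ : ℕ → Carrier K} → ρ ∘ r ≗ ρ′ → (a ◂ ρ) ∘ lift r ≗ (a ◂ ρ′)
  lift-◂ a h zero    = refl
  lift-◂ a h (suc i) = h i

  ren-sat : ∀ φ {r ρ ρ′} → ρ ∘ r ≗ ρ′ → RSat K (ren r φ) ρ ⟺ RSat K φ ρ′
  ren-sat (s r≐ t) h = ⟺-≡ (renT-eval s h) (renT-eval t h)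
  ren-sat (s r≼ t) h = ⟺-rel _≤_ (renT-eval s h) (renT-eval t h)
  ren-sat r⊥       h = ⟺-refl
  ren-sat (φ r⇒ ψ) h = ⟺-→ (ren-sat φ h) (ren-sat ψ h)
  ren-sat (r∀ φ)   h = ⟺-∀ (λ a → ren-sat φ (lift-◂ a h))

-- Passing between scoped and raw formulas

rawTerm : ∀ {n} → (Fin n → ℕ) → Term n → RTerm
rawTerm r (var i)  = rvar (r i)
rawTerm r `0       = r0
rawTerm r `1       = r1
rawTerm r (s `+ t) = rawTerm r s r+ rawTerm r t
rawTerm r (s `* t) = rawTerm r s r* rawTerm r t

raw : ∀ {n} → (Fin n → ℕ) → Formula n → RFormula
raw r (s ≐ t) = rawTerm r s r≐ rawTerm r t
raw r (s ≼ t) = rawTerm r s r≼ rawTerm r t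
raw r ⊥'      = r⊥
raw r (φ ⇒ ψ) = raw r φ r⇒ raw r ψ
raw r (∀' φ)  = r∀ (raw (0 ∷ suc ∘ r) φ)

module _ (K : Structure) where
  open Structure K using (_+_; _*_; _≤_)

  rawTerm-eval : ∀ {n} (t : Term n) {r ρ ρ′} → (∀ i → ρ′ i ≡ ρ (r i)) →
                 eval K t ρ′ ≡ REval K (rawTerm r t) ρ
  rawTerm-eval (var i)  h = h i
  rawTerm-eval `0       h = refl
  rawTerm-eval `1       h = refl
  rawTerm-eval (s `+ t) h = cong₂ _+_ (rawTerm-eval s h) (rawTerm-eval t h)
  rawTerm-eval (s `* t) h = cong₂ _*_ (rawTerm-eval s h) (rawTerm-eval t h)

  raw-sat : ∀ {n} (φ : Formula n) {r ρ ρ′} → (∀ i → ρ′ i ≡ ρ (r i)) →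
            Sat K φ ρ′ ⟺ RSat K (raw r φ) ρ
  raw-sat (s ≐ t) h = ⟺-≡ (rawTerm-eval s h) (rawTerm-eval t h)
  raw-sat (s ≼ t) h = ⟺-rel _≤_ (rawTerm-eval s h) (rawTerm-eval t h)
  raw-sat ⊥'      h = ⟺-refl
  raw-sat (φ ⇒ ψ) h = ⟺-→ (raw-sat φ h) (raw-sat ψ h)
  raw-sat (∀' φ)  h = ⟺-∀ (λ a → raw-sat φ (λ { zero → refl ; (suc i) → h i }))

boundT : RTerm → ℕ
boundT (rvar i) = suc i
boundT r0       = 0
boundT r1       = 0
boundT (s r+ t) = boundT s ⊔ boundT t
boundT (s r* t) = boundT s ⊔ boundT t

bound : RFormula → ℕ
bound (s r≐ t) = boundT s ⊔ boundT t
bound (s r≼ t) = boundT s ⊔ boundT t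
bound r⊥       = 0
bound (φ r⇒ ψ) = bound φ ⊔ bound ψ
bound (r∀ φ)   = pred (bound φ)

pred≤⇒≤suc : ∀ {m n} → pred m ℕ.≤ n → m ℕ.≤ suc n
pred≤⇒≤suc {zero}  _ = ℕ.z≤n
pred≤⇒≤suc {suc m} p = ℕ.s≤s p

-- Variables that are out of range become `0; the scope hypothesis bound φ ≤ n excludes them.
scopedVar : ∀ n i → Dec (i ℕ.< n) → Term n
scopedVar n i (yes p) = var (fromℕ< p)
scopedVar n i (no _)  = `0

scopedT : ∀ n → RTerm → Term n
scopedT n (rvar i) = scopedVar n i (i ℕ.<? n)
scopedT n r0       = `0
scopedT n r1       = `1
scopedT n (s r+ t) = scopedT n s `+ scopedT n t
scopedT n (s r* t) = scopedT n s `* scopedT n t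

scoped : ∀ n → RFormula → Formula n
scoped n (s r≐ t) = scopedT n s ≐ scopedT n t
scoped n (s r≼ t) = scopedT n s ≼ scopedT n t
scoped n r⊥       = ⊥'
scoped n (φ r⇒ ψ) = scoped n φ ⇒ scoped n ψ
scoped n (r∀ φ)   = ∀' (scoped (suc n) φ)

module _ (K : Structure) where
  open Structure K using (_+_; _*_; _≤_)

  private
    Agree : ∀ n → (Fin n → Carrier K) → (ℕ → Carrier K) → Set
    Agree n ρ ρ′ = ∀ i → ρ i ≡ ρ′ (toℕ i)

  scopedVar-eval : ∀ n i d {ρ ρ′} → i ℕ.< n → Agree n ρ ρ′ → eval K (scopedVar n i d) ρ ≡ ρ′ i
  scopedVar-eval n i (yes p) {ρ′ = ρ′} b h = trans (h (fromℕ< p)) (cong ρ′ (toℕ-fromℕ< p))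
  scopedVar-eval n i (no q)  b h = ⊥-elim (q b)

  scopedT-eval : ∀ n t {ρ ρ′} → boundT t ℕ.≤ n → Agree n ρ ρ′ → eval K (scopedT n t) ρ ≡ REval K t ρ′
  scopedT-eval n (rvar i) b h = scopedVar-eval n i (i ℕ.<? n) b h
  scopedT-eval n r0       b h = refl
  scopedT-eval n r1       b h = refl
  scopedT-eval n (s r+ t) b h =
    cong₂ _+_ (scopedT-eval n s (ℕₚ.m⊔n≤o⇒m≤o _ _ b) h) (scopedT-eval n t (ℕₚ.m⊔n≤o⇒n≤o _ _ b) h)
  scopedT-eval n (s r* t) b h =
    cong₂ _*_ (scopedT-eval n s (ℕₚ.m⊔n≤o⇒m≤o _ _ b) h) (scopedT-eval n t (ℕₚ.m⊔n≤o⇒n≤o _ _ b) h)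

  scoped-sat : ∀ n φ {ρ ρ′} → bound φ ℕ.≤ n → Agree n ρ ρ′ → Sat K (scoped n φ) ρ ⟺ RSat K φ ρ′
  scoped-sat n (s r≐ t) b h =
    ⟺-≡ (scopedT-eval n s (ℕₚ.m⊔n≤o⇒m≤o _ _ b) h) (scopedT-eval n t (ℕₚ.m⊔n≤o⇒n≤o _ _ b) h)
  scoped-sat n (s r≼ t) b h =
    ⟺-rel _≤_ (scopedT-eval n s (ℕₚ.m⊔n≤o⇒m≤o _ _ b) h) (scopedT-eval n t (ℕₚ.m⊔n≤o⇒n≤o _ _ b) h)
  scoped-sat n r⊥       b h = ⟺-refl
  scoped-sat n (φ r⇒ ψ) b h =
    ⟺-→ (scoped-sat n φ (ℕₚ.m⊔n≤o⇒m≤o _ _ b) h) (scoped-sat n ψ (ℕₚ.m⊔n≤o⇒n≤o _ _ b) h)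
  scoped-sat n (r∀ φ)   b h =
    ⟺-∀ (λ a → scoped-sat (suc n) φ (pred≤⇒≤suc b) (λ { zero → refl ; (suc i) → h i }))

-- Elementarity is given for formulas with finitely many variables. A raw formula looks at no
-- variable beyond `bound φ`, so it can be scoped there, transferred and read back.
elem-raw : ∀ {M N} (f : ElemEmb M N) φ ρ → RSat M φ ρ ⟺ RSat N φ (emb f ∘ ρ)
elem-raw {M} {N} f φ ρ =
  ⟺-trans (⟺-sym (scoped-sat M (bound φ) φ ℕₚ.≤-refl (λ _ → refl)))
    (⟺-trans (elem f (scoped (bound φ) φ) (ρ ∘ toℕ))
      (scoped-sat N (bound φ) φ ℕₚ.≤-refl (λ _ → refl)))

-- A numbering of the raw formulas

-- One step of Cantor's walk along the antidiagonals. Surjectivity then follows by moving along one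
-- antidiagonal at a time, without a closed formula for the pairing.
next : ℕ × ℕ → ℕ × ℕ
next (zero , y)  = suc y , zero
next (suc x , y) = x , suc y

unpair : ℕ → ℕ × ℕ
unpair zero    = zero , zero
unpair (suc k) = next (unpair k)

unpair-diagonal : ∀ y {x z k} → unpair k ≡ (y ℕ.+ x , z) → unpair (y ℕ.+ k) ≡ (x , y ℕ.+ z)
unpair-diagonal zero    p = p
unpair-diagonal (suc y) {x} {z} p =
  cong next (unpair-diagonal y (trans p (cong (_, z) (sym (ℕₚ.+-suc y x)))))

unpair-axis : ∀ s → Σ[ k ∈ ℕ ] unpair k ≡ (s , 0)
unpair-axis zero    = 0 , refl
unpair-axis (suc s) with unpair-axis s
... | k , p = suc (s ℕ.+ k) ,
  trans (cong next (unpair-diagonal s (trans p (cong (_, 0) (sym (ℕₚ.+-identityʳ s))))))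
        (cong (λ t → suc t , 0) (ℕₚ.+-identityʳ s))

opaque
  unpair-surjective : ∀ x y → Σ[ k ∈ ℕ ] unpair k ≡ (x , y)
  unpair-surjective x y with unpair-axis (y ℕ.+ x)
  ... | k , p = y ℕ.+ k , trans (unpair-diagonal y p) (cong (x ,_) (ℕₚ.+-identityʳ y))

pair : ℕ → ℕ → ℕ
pair x y = proj₁ (unpair-surjective x y)

unpair-pair : ∀ x y → unpair (pair x y) ≡ (x , y)
unpair-pair x y = proj₂ (unpair-surjective x y)

mutual
  -- The first argument is fuel, because splitting a code with `unpair` is no structural descent.
  -- The value returned when the fuel is used up is arbitrary.
  decT : ℕ → ℕ → RTerm
  decT zero    n = r0
  decT (suc f) n = decTagT f (unpair n)

  decTagT : ℕ → ℕ × ℕ → RTerm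
  decTagT f (0 , m) = rvar m
  decTagT f (1 , m) = r0
  decTagT f (2 , m) = r1
  decTagT f (3 , m) = decT f (proj₁ (unpair m)) r+ decT f (proj₂ (unpair m))
  decTagT f (_ , m) = decT f (proj₁ (unpair m)) r* decT f (proj₂ (unpair m))

mutual
  dec : ℕ → ℕ → RFormula
  dec zero    n = r⊥
  dec (suc f) n = decTag f (unpair n)

  decTag : ℕ → ℕ × ℕ → RFormula
  decTag f (0 , m) = decT f (proj₁ (unpair m)) r≐ decT f (proj₂ (unpair m))
  decTag f (1 , m) = decT f (proj₁ (unpair m)) r≼ decT f (proj₂ (unpair m))
  decTag f (2 , m) = r⊥
  decTag f (3 , m) = dec f (proj₁ (unpair m)) r⇒ dec f (proj₂ (unpair m))
  decTag f (_ , m) = r∀ (dec f m)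

depthT : RTerm → ℕ
depthT (s r+ t) = suc (depthT s ⊔ depthT t)
depthT (s r* t) = suc (depthT s ⊔ depthT t)
depthT _        = 1

depth : RFormula → ℕ
depth (s r≐ t) = suc (depthT s ⊔ depthT t)
depth (s r≼ t) = suc (depthT s ⊔ depthT t)
depth r⊥       = 1
depth (φ r⇒ ψ) = suc (depth φ ⊔ depth ψ)
depth (r∀ φ)   = suc (depth φ)

encT : RTerm → ℕ
encT (rvar i) = pair 0 i
encT r0       = pair 1 0
encT r1       = pair 2 0
encT (s r+ t) = pair 3 (pair (encT s) (encT t))
encT (s r* t) = pair 4 (pair (encT s) (encT t))

enc : RFormula → ℕ
enc (s r≐ t) = pair 0 (pair (encT s) (encT t))
enc (s r≼ t) = pair 1 (pair (encT s) (encT t))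
enc r⊥       = pair 2 0
enc (φ r⇒ ψ) = pair 3 (pair (enc φ) (enc ψ))
enc (r∀ φ)   = pair 4 (enc φ)

private
  unpair₂ : ∀ {A B D : Set} (g : A → B → D) (h : ℕ → A) (k : ℕ → B) x y {a b} →
            h x ≡ a → k y ≡ b →
            g (h (proj₁ (unpair (pair x y)))) (k (proj₂ (unpair (pair x y)))) ≡ g a b
  unpair₂ g h k x y p q rewrite unpair-pair x y = cong₂ g p q

decT-encT : ∀ f t → depthT t ℕ.≤ f → decT f (encT t) ≡ t
decT-encT (suc f) (rvar i) b = cong (decTagT f) (unpair-pair 0 i)
decT-encT (suc f) r0       b = cong (decTagT f) (unpair-pair 1 0)
decT-encT (suc f) r1       b = cong (decTagT f) (unpair-pair 2 0)
decT-encT (suc f) (s r+ t) (ℕ.s≤s b) = trans (cong (decTagT f) (unpair-pair 3 _))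
  (unpair₂ _r+_ (decT f) (decT f) _ _
    (decT-encT f s (ℕₚ.m⊔n≤o⇒m≤o _ _ b)) (decT-encT f t (ℕₚ.m⊔n≤o⇒n≤o _ _ b)))
decT-encT (suc f) (s r* t) (ℕ.s≤s b) = trans (cong (decTagT f) (unpair-pair 4 _))
  (unpair₂ _r*_ (decT f) (decT f) _ _
    (decT-encT f s (ℕₚ.m⊔n≤o⇒m≤o _ _ b)) (decT-encT f t (ℕₚ.m⊔n≤o⇒n≤o _ _ b)))

dec-enc : ∀ f φ → depth φ ℕ.≤ f → dec f (enc φ) ≡ φ
dec-enc (suc f) (s r≐ t) (ℕ.s≤s b) = trans (cong (decTag f) (unpair-pair 0 _))
  (unpair₂ _r≐_ (decT f) (decT f) _ _
    (decT-encT f s (ℕₚ.m⊔n≤o⇒m≤o _ _ b)) (decT-encT f t (ℕₚ.m⊔n≤o⇒n≤o _ _ b)))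
dec-enc (suc f) (s r≼ t) (ℕ.s≤s b) = trans (cong (decTag f) (unpair-pair 1 _))
  (unpair₂ _r≼_ (decT f) (decT f) _ _
    (decT-encT f s (ℕₚ.m⊔n≤o⇒m≤o _ _ b)) (decT-encT f t (ℕₚ.m⊔n≤o⇒n≤o _ _ b)))
dec-enc (suc f) r⊥       b = cong (decTag f) (unpair-pair 2 0)
dec-enc (suc f) (φ r⇒ ψ) (ℕ.s≤s b) = trans (cong (decTag f) (unpair-pair 3 _))
  (unpair₂ _r⇒_ (dec f) (dec f) _ _
    (dec-enc f φ (ℕₚ.m⊔n≤o⇒m≤o _ _ b)) (dec-enc f ψ (ℕₚ.m⊔n≤o⇒n≤o _ _ b)))
dec-enc (suc f) (r∀ φ)   (ℕ.s≤s b) =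
  trans (cong (decTag f) (unpair-pair 4 _)) (cong r∀ (dec-enc f φ b))

-- A code carries its own fuel; putting the depth of the formula there makes the numbering
-- surjective.
formula : ℕ → RFormula
formula k = dec (proj₁ (unpair k)) (proj₂ (unpair k))

formula-surjective : ∀ φ → Σ[ k ∈ ℕ ] formula k ≡ φ
formula-surjective φ = pair (depth φ) (enc φ) ,
  trans (cong (λ p → dec (proj₁ p) (proj₂ p)) (unpair-pair _ _)) (dec-enc (depth φ) φ ℕₚ.≤-refl)

-- Classical connectives

infixr 6 _r∧_ _r∨_

r¬ : RFormula → RFormula
r¬ φ = φ r⇒ r⊥

_r∧_ _r∨_ : RFormula → RFormula → RFormula
φ r∧ ψ = r¬ (φ r⇒ r¬ ψ)
φ r∨ ψ = r¬ φ r⇒ ψ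

r∃ : RFormula → RFormula
r∃ φ = r¬ (r∀ (r¬ φ))

module Classical (em : ExcludedMiddle 0ℓ) where

  by-contradiction : {A : Set} → ¬ ¬ A → A
  by-contradiction {A} h with em {A}
  ... | yes a = a
  ... | no ¬a = ⊥-elim (h ¬a)

  module _ (K : Structure) where

    r∧-sat : ∀ φ ψ ρ → (RSat K φ ρ × RSat K ψ ρ) ⟺ RSat K (φ r∧ ψ) ρ
    r∧-sat φ ψ ρ = (λ (p , q) h → h p q) ,
             (λ h → by-contradiction (λ n → h (λ p q → n (p , q))))

    r∨-sat : ∀ φ ψ ρ → (RSat K φ ρ ⊎ RSat K ψ ρ) ⟺ RSat K (φ r∨ ψ) ρ
    r∨-sat φ ψ ρ = (λ { (inj₁ p) n → ⊥-elim (n p) ; (inj₂ q) _ → q }) ,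
             (λ h → by-contradiction (λ n → n (inj₂ (h (λ p → n (inj₁ p))))))

    r∃-sat : ∀ φ ρ → (Σ[ a ∈ Carrier K ] RSat K φ (a ◂ ρ)) ⟺ RSat K (r∃ φ) ρ
    r∃-sat φ ρ = (λ (a , p) h → h a p) ,
             (λ h → by-contradiction (λ n → h (λ a p → n (a , p))))

-- Definability with parameters

infixr 5 _▷_
_▷_ : ∀ {A : Set} {k} → (Fin k → A) → (ℕ → A) → ℕ → A
_▷_ {k = zero}  v ρ = ρ
_▷_ {k = suc k} v ρ = v zero ◂ ((λ i → v (suc i)) ▷ ρ)

▷-params : ∀ {A : Set} {k} (v : Fin k → A) (ρ : ℕ → A) i → (v ▷ ρ) (k ℕ.+ i) ≡ ρ i
▷-params {k = zero}  v ρ i = refl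
▷-params {k = suc k} v ρ i = ▷-params (λ i → v (suc i)) ρ i

▷-var : ∀ {A : Set} {k} (v : Fin k → A) (ρ : ℕ → A) i → (v ▷ ρ) (toℕ i) ≡ v i
▷-var v ρ zero    = refl
▷-var v ρ (suc i) = ▷-var (λ i → v (suc i)) ρ i

lifts : ℕ → (ℕ → ℕ) → ℕ → ℕ
lifts zero    r = r
lifts (suc k) r = lift (lifts k r)

lifts-▷ : ∀ {A : Set} {k} (w : Fin k → A) {r} {ρ ρ′ : ℕ → A} → ρ ∘ r ≗ ρ′ →
          (w ▷ ρ) ∘ lifts k r ≗ (w ▷ ρ′)
lifts-▷ {k = zero}  w h = h
lifts-▷ {k = suc k} w h zero    = refl
lifts-▷ {k = suc k} w h (suc i) = lifts-▷ (λ i → w (suc i)) h i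

module Definability (em : ExcludedMiddle 0ℓ) (M : Structure)
                    (en : ℕ → Carrier M) (surj : ∀ m → Σ[ k ∈ ℕ ] en k ≡ m) where

  open Classical em public

  C : Set
  C = Carrier M

  -- The parameters of a definable set are values of the enumeration en of the whole model.
  Def : ∀ k → ((Fin k → C) → Set) → Set
  Def k P = Σ[ φ ∈ RFormula ] (∀ v → P v ⟺ RSat M φ (v ▷ en))

  DefFun : ∀ k → ((Fin k → C) → C) → Set
  DefFun k f = Def (suc k) (λ w → w zero ≡ f (λ i → w (suc i)))

  Def-resp : ∀ {k P Q} → (∀ v → P v ⟺ Q v) → Def k P → Def k Q
  Def-resp h (φ , p) = φ , (λ v → ⟺-trans (⟺-sym (h v)) (p v))

  -- Only graphs of the functions `g i` are available, not terms, so substitution is done by a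
  -- quantifier: `r∃` guesses the value of the leading variable and the graph `γ` pins it down. The
  -- other variables of `γ` are shifted past the k values that still stand in front of them.
  subst-formula : ∀ {n} k (g : Fin k → (Fin n → C) → C) → (∀ i → DefFun n (g i)) → (φ : RFormula) →
                  Σ[ ψ ∈ RFormula ] (∀ v → RSat M φ ((λ i → g i v) ▷ (v ▷ en)) ⟺ RSat M ψ (v ▷ en))
  subst-formula zero    g d φ = φ , λ v → ⟺-refl
  subst-formula {n} (suc k) g d φ =
    let γ , γ-sat = d zero
        γ′ = ren (lift (k ℕ.+_)) γ
        rest = λ v → (λ i → g (suc i) v) ▷ (v ▷ en)
        ψ , ψ-sat = subst-formula k (g ∘ suc) (d ∘ suc) (r∃ (γ′ r∧ φ))
        graph : ∀ v y → (y ≡ g zero v) ⟺ RSat M γ′ (y ◂ rest v)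
        graph v y = ⟺-trans (γ-sat (y ∷ v))
          (⟺-sym (ren-sat M γ (lift-◂ M y (▷-params (λ i → g (suc i) v) (v ▷ en)))))
    in ψ , λ v → ⟺-trans
      ( (λ p → proj₁ (r∃-sat M (γ′ r∧ φ) (rest v))
                 (g zero v , proj₁ (r∧-sat M γ′ φ _) (proj₁ (graph v _) refl , p)))
      , (λ p → let y , q = proj₂ (r∃-sat M (γ′ r∧ φ) (rest v)) p
                   a , b = proj₂ (r∧-sat M γ′ φ (y ◂ rest v)) q
               in subst (λ y → RSat M φ (y ◂ rest v)) (proj₂ (graph v y) a) b))
      (ψ-sat v)

  subst-Def : ∀ {n k P} (g : Fin k → (Fin n → C) → C) → (∀ i → DefFun n (g i)) → Def k P →
              Def n (λ v → P (λ i → g i v))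
  subst-Def {n} {k} g d (φ , φ-sat) =
    -- The parameters of `φ` come right after its k arguments; the n variables of `v` now stand in
    -- between.
    let ψ , ψ-sat = subst-formula k g d (ren (lifts k (n ℕ.+_)) φ)
    in ψ , λ v → ⟺-trans (φ-sat (λ i → g i v))
      (⟺-trans (⟺-sym (ren-sat M φ (lifts-▷ (λ i → g i v) (▷-params v en)))) (ψ-sat v))

  weaken-DefFun : ∀ {n f} → DefFun n f → DefFun (suc n) (λ w → f (λ i → w (suc i)))
  weaken-DefFun (φ , φ-sat) = ren (lift suc) φ , λ w →
    ⟺-trans (φ-sat (w zero ∷ (λ i → w (suc (suc i)))))
      (⟺-sym (ren-sat M φ (lift-◂ M (w zero) (λ _ → refl))))

  proj-DefFun : ∀ {n} i → DefFun n (λ v → v i)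
  proj-DefFun {n} i = (rvar 0 r≐ rvar (suc (toℕ i))) ,
    λ w → ⟺-≡ refl (sym (▷-var (λ i → w (suc i)) en i))

  const-DefFun : ∀ {n} c → DefFun n (λ v → c)
  const-DefFun {n} c = (rvar 0 r≐ rvar (suc (n ℕ.+ proj₁ (surj c)))) ,
    λ w → ⟺-≡ refl (sym (trans (▷-params (λ i → w (suc i)) en _) (proj₂ (surj c))))

  compose-DefFun : ∀ {n k f} (g : Fin k → (Fin n → C) → C) → (∀ i → DefFun n (g i)) →
                   DefFun k f → DefFun n (λ v → f (λ i → g i v))
  compose-DefFun {n} {k} {f} g d f-def = subst-Def {k = suc k}
    ((λ w → w zero) ∷ (λ i w → g i (λ j → w (suc j))))
    (λ { zero → proj-DefFun zero ; (suc i) → weaken-DefFun {f = g i} (d i) })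
    f-def

  -- Formulas whose atoms are arbitrary definable predicates and functions: the interpretation of such
  -- a formula unfolds to the Agda statement that one wants to be definable.
  data Tm (n : ℕ) : Set where
    `_  : Fin n → Tm n
    con : C → Tm n
    app : ∀ {k} (f : (Fin k → C) → C) → DefFun k f → (Fin k → Tm n) → Tm n

  infixr 4 _⊃_
  infixr 5 _∨_
  infixr 6 _∧_

  data Fm (n : ℕ) : Set₁ where
    atom        : ∀ {k} (P : (Fin k → C) → Set) → Def k P → (Fin k → Tm n) → Fm n
    _⊃_ _∧_ _∨_ : Fm n → Fm n → Fm n
    ⊥ᶠ          : Fm n
    ∀ᶠ ∃ᶠ       : Fm (suc n) → Fm n

  ⟦_⟧ₜ : ∀ {n} → Tm n → (Fin n → C) → C
  ⟦ ` i ⟧ₜ        v = v i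
  ⟦ con c ⟧ₜ      v = c
  ⟦ app f d ts ⟧ₜ v = f (λ i → ⟦ ts i ⟧ₜ v)

  ⟦_⟧ : ∀ {n} → Fm n → (Fin n → C) → Set
  ⟦ atom P d ts ⟧ v = P (λ i → ⟦ ts i ⟧ₜ v)
  ⟦ φ ⊃ ψ ⟧       v = ⟦ φ ⟧ v → ⟦ ψ ⟧ v
  ⟦ φ ∧ ψ ⟧       v = ⟦ φ ⟧ v × ⟦ ψ ⟧ v
  ⟦ φ ∨ ψ ⟧       v = ⟦ φ ⟧ v ⊎ ⟦ ψ ⟧ v
  ⟦ ⊥ᶠ ⟧          v = ⊥
  ⟦ ∀ᶠ φ ⟧        v = ∀ a → ⟦ φ ⟧ (a ∷ v)
  ⟦ ∃ᶠ φ ⟧        v = Σ[ a ∈ C ] ⟦ φ ⟧ (a ∷ v)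

  opaque
    definableₜ : ∀ {n} (t : Tm n) → DefFun n ⟦ t ⟧ₜ
    definableₜ (` i)        = proj-DefFun i
    definableₜ (con c)      = const-DefFun c
    definableₜ (app f d ts) = compose-DefFun {f = f} (λ i → ⟦ ts i ⟧ₜ) (λ i → definableₜ (ts i)) d

    definable : ∀ {n} (φ : Fm n) → Def n ⟦ φ ⟧
    definable (atom P d ts) = subst-Def (λ i → ⟦ ts i ⟧ₜ) (λ i → definableₜ (ts i)) d
    definable (φ ⊃ ψ) = let a , p = definable φ ; b , q = definable ψ in
      (a r⇒ b) , λ v → ⟺-→ (p v) (q v)
    definable (φ ∧ ψ) = let a , p = definable φ ; b , q = definable ψ in
      (a r∧ b) , λ v → ⟺-trans
        ( (λ (x , y) → proj₁ (p v) x , proj₁ (q v) y)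
        , (λ (x , y) → proj₂ (p v) x , proj₂ (q v) y)) (r∧-sat M a b _)
    definable (φ ∨ ψ) = let a , p = definable φ ; b , q = definable ψ in
      (a r∨ b) , λ v → ⟺-trans
        ( (λ { (inj₁ x) → inj₁ (proj₁ (p v) x) ; (inj₂ y) → inj₂ (proj₁ (q v) y) })
        , (λ { (inj₁ x) → inj₁ (proj₂ (p v) x) ; (inj₂ y) → inj₂ (proj₂ (q v) y) })) (r∨-sat M a b _)
    definable ⊥ᶠ = r⊥ , λ v → ⟺-refl
    definable (∀ᶠ φ) = let a , p = definable φ in
      r∀ a , λ v → ⟺-∀ (λ x → p (x ∷ v))
    definable (∃ᶠ φ) = let a , p = definable φ in
      r∃ a , λ v → ⟺-trans
        ( (λ (x , h) → x , proj₁ (p (x ∷ v)) h)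
        , (λ (x , h) → x , proj₂ (p (x ∷ v)) h)) (r∃-sat M a _)

  -- Records, so that the function or predicate can be inferred from its definability proof.
  record Fun₁ (f : C → C) : Set where
    constructor ⟨_⟩
    field def : DefFun 1 (λ v → f (v zero))

  record Fun₂ (f : C → C → C) : Set where
    constructor ⟨_⟩
    field def : DefFun 2 (λ v → f (v zero) (v (suc zero)))

  record Fun₃ (f : C → C → C → C) : Set where
    constructor ⟨_⟩
    field def : DefFun 3 (λ v → f (v zero) (v (suc zero)) (v (suc (suc zero))))

  record Def₁ (P : C → Set) : Set where
    constructor ⟨_⟩
    field def : Def 1 (λ v → P (v zero))

  record Def₂ (P : C → C → Set) : Set where
    constructor ⟨_⟩
    field def : Def 2 (λ v → P (v zero) (v (suc zero)))

  record Def₃ (P : C → C → C → Set) : Set where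
    constructor ⟨_⟩
    field def : Def 3 (λ v → P (v zero) (v (suc zero)) (v (suc (suc zero))))

  fun₁ : ∀ {n f} → Fun₁ f → Tm n → Tm n
  fun₁ {f = f} ⟨ d ⟩ t = app (λ v → f (v zero)) d (t ∷ [])

  fun₂ : ∀ {n f} → Fun₂ f → Tm n → Tm n → Tm n
  fun₂ {f = f} ⟨ d ⟩ s t = app (λ v → f (v zero) (v (suc zero))) d (s ∷ t ∷ [])

  fun₃ : ∀ {n f} → Fun₃ f → Tm n → Tm n → Tm n → Tm n
  fun₃ {f = f} ⟨ d ⟩ s t u = app (λ v → f (v zero) (v (suc zero)) (v (suc (suc zero)))) d (s ∷ t ∷ u ∷ [])

  rel₁ : ∀ {n P} → Def₁ P → Tm n → Fm n
  rel₁ {P = P} ⟨ d ⟩ t = atom (λ v → P (v zero)) d (t ∷ [])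

  rel₂ : ∀ {n P} → Def₂ P → Tm n → Tm n → Fm n
  rel₂ {P = P} ⟨ d ⟩ s t = atom (λ v → P (v zero) (v (suc zero))) d (s ∷ t ∷ [])

  rel₃ : ∀ {n P} → Def₃ P → Tm n → Tm n → Tm n → Fm n
  rel₃ {P = P} ⟨ d ⟩ s t u = atom (λ v → P (v zero) (v (suc zero)) (v (suc (suc zero)))) d (s ∷ t ∷ u ∷ [])

  open Structure M using (𝟎; 𝟏; _+_; _*_; _≤_)

  infix  7 _≈ᶠ_ _≤ᶠ_
  infixl 9 _+ᶠ_
  infixl 10 _*ᶠ_

  _≈ᶠ_ _≤ᶠ_ : ∀ {n} → Tm n → Tm n → Fm n
  _≈ᶠ_ = rel₂ {P = _≡_} ⟨ ((rvar 0 r≐ rvar 1) , λ v → ⟺-refl) ⟩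
  _≤ᶠ_ = rel₂ {P = _≤_} ⟨ ((rvar 0 r≼ rvar 1) , λ v → ⟺-refl) ⟩

  _+ᶠ_ _*ᶠ_ : ∀ {n} → Tm n → Tm n → Tm n
  _+ᶠ_ = fun₂ {f = _+_} ⟨ ((rvar 0 r≐ (rvar 1 r+ rvar 2)) , λ v → ⟺-refl) ⟩
  _*ᶠ_ = fun₂ {f = _*_} ⟨ ((rvar 0 r≐ (rvar 1 r* rvar 2)) , λ v → ⟺-refl) ⟩

  0ᶠ 1ᶠ : ∀ {n} → Tm n
  0ᶠ = con 𝟎
  1ᶠ = con 𝟏

  ¬ᶠ_ : ∀ {n} → Fm n → Fm n
  ¬ᶠ φ = φ ⊃ ⊥ᶠ

  v0 : ∀ {n} → Tm (suc n)
  v0 = ` zero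
  v1 : ∀ {n} → Tm (suc (suc n))
  v1 = ` (suc zero)
  v2 : ∀ {n} → Tm (suc (suc (suc n)))
  v2 = ` (suc (suc zero))
  v3 : ∀ {n} → Tm (suc (suc (suc (suc n))))
  v3 = ` (suc (suc (suc zero)))
  v4 : ∀ {n} → Tm (suc (suc (suc (suc (suc n)))))
  v4 = ` (suc (suc (suc (suc zero))))

-- Semiring and order in a model of PA

module Arithmetic (em : ExcludedMiddle 0ℓ) (M : Structure) (pa : IsPA M)
                  (en : ℕ → Carrier M) (surj : ∀ m → Σ[ k ∈ ℕ ] en k ≡ m) where

  open Definability em M en surj public
  open Structure M public using (𝟎; 𝟏; _+_; _*_; _≤_)
  open IsPA pa public using (succ≢0; succ-inj; +-0; +-succ; *-0; *-succ; ≤-def; induction)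

  opaque
    -- Definability turns the statement into a raw formula with parameters in `en`; cutting the
    -- environment at `bound ψ` gives an instance of the induction schema.
    ind : (φ : Fm 1) → ⟦ φ ⟧ (𝟎 ∷ []) → (∀ x → ⟦ φ ⟧ (x ∷ []) → ⟦ φ ⟧ ((x + 𝟏) ∷ [])) →
          ∀ x → ⟦ φ ⟧ (x ∷ [])
    ind φ base step x = proj₂ (transfer x) (induction (scoped (suc b) ψ) (en ∘ toℕ)
        (proj₁ (transfer 𝟎) base)
        (λ y p → proj₁ (transfer (y + 𝟏)) (step y (proj₂ (transfer y) p))) x)
      where
      ψ : RFormula
      ψ = proj₁ (definable φ)
      b : ℕ
      b = bound ψ
      transfer : ∀ y → ⟦ φ ⟧ (y ∷ []) ⟺ Sat M (scoped (suc b) ψ) (y ∷ (en ∘ toℕ))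
      transfer y = ⟺-trans (proj₂ (definable φ) (y ∷ []))
        (⟺-sym (scoped-sat M (suc b) ψ {y ∷ (en ∘ toℕ)} {y ◂ en} (ℕₚ.n≤1+n b)
          (λ { zero → refl ; (suc i) → refl })))

  open ≡-Reasoning

  +-assoc : ∀ x y z → (x + y) + z ≡ x + (y + z)
  +-assoc x y = ind ((con x +ᶠ con y) +ᶠ v0 ≈ᶠ con x +ᶠ (con y +ᶠ v0))
    (trans (+-0 _) (cong (x +_) (sym (+-0 y))))
    λ z h → begin
      (x + y) + (z + 𝟏) ≡⟨ +-succ _ _ ⟩
      (x + y) + z + 𝟏   ≡⟨ cong (_+ 𝟏) h ⟩
      x + (y + z) + 𝟏   ≡⟨ +-succ _ _ ⟨
      x + (y + z + 𝟏)   ≡⟨ cong (x +_) (+-succ y z) ⟨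
      x + (y + (z + 𝟏)) ∎

  +-identityˡ : ∀ x → 𝟎 + x ≡ x
  +-identityˡ = ind (0ᶠ +ᶠ v0 ≈ᶠ v0) (+-0 𝟎) λ x h → trans (+-succ 𝟎 x) (cong (_+ 𝟏) h)

  +-succˡ : ∀ x y → (x + 𝟏) + y ≡ (x + y) + 𝟏
  +-succˡ x = ind ((con x +ᶠ 1ᶠ) +ᶠ v0 ≈ᶠ (con x +ᶠ v0) +ᶠ 1ᶠ)
    (trans (+-0 _) (cong (_+ 𝟏) (sym (+-0 x))))
    λ y h → trans (+-succ _ y) (trans (cong (_+ 𝟏) h) (cong (_+ 𝟏) (sym (+-succ x y))))

  +-comm : ∀ x y → x + y ≡ y + x
  +-comm x = ind (con x +ᶠ v0 ≈ᶠ v0 +ᶠ con x)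
    (trans (+-0 x) (sym (+-identityˡ x)))
    λ y h → trans (+-succ x y) (trans (cong (_+ 𝟏) h) (sym (+-succˡ y x)))

  *-distribˡ : ∀ x y z → x * (y + z) ≡ x * y + x * z
  *-distribˡ x y = ind (con x *ᶠ (con y +ᶠ v0) ≈ᶠ con x *ᶠ con y +ᶠ con x *ᶠ v0)
    (trans (cong (x *_) (+-0 y)) (trans (sym (+-0 _)) (cong (x * y +_) (sym (*-0 x)))))
    λ z h → begin
      x * (y + (z + 𝟏))     ≡⟨ cong (x *_) (+-succ y z) ⟩
      x * (y + z + 𝟏)       ≡⟨ *-succ _ _ ⟩
      x * (y + z) + x       ≡⟨ cong (_+ x) h ⟩
      x * y + x * z + x     ≡⟨ +-assoc _ _ _ ⟩
      x * y + (x * z + x)   ≡⟨ cong (x * y +_) (*-succ x z) ⟨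
      x * y + x * (z + 𝟏)   ∎

  *-zeroˡ : ∀ x → 𝟎 * x ≡ 𝟎
  *-zeroˡ = ind (0ᶠ *ᶠ v0 ≈ᶠ 0ᶠ) (*-0 𝟎) λ x h → trans (*-succ 𝟎 x) (trans (+-0 _) h)

  *-succˡ : ∀ x y → (x + 𝟏) * y ≡ x * y + y
  *-succˡ x = ind ((con x +ᶠ 1ᶠ) *ᶠ v0 ≈ᶠ con x *ᶠ v0 +ᶠ v0)
    (trans (*-0 _) (sym (trans (+-0 _) (*-0 x))))
    λ y h → begin
      (x + 𝟏) * (y + 𝟏)     ≡⟨ *-succ _ _ ⟩
      (x + 𝟏) * y + (x + 𝟏) ≡⟨ cong (_+ (x + 𝟏)) h ⟩
      x * y + y + (x + 𝟏)   ≡⟨ +-assoc _ _ _ ⟩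
      x * y + (y + (x + 𝟏)) ≡⟨ cong (x * y +_) (trans (+-succ y x) (cong (_+ 𝟏) (+-comm y x))) ⟩
      x * y + (x + y + 𝟏)   ≡⟨ cong (x * y +_) (+-succ x y) ⟨
      x * y + (x + (y + 𝟏)) ≡⟨ +-assoc _ _ _ ⟨
      x * y + x + (y + 𝟏)   ≡⟨ cong (_+ (y + 𝟏)) (*-succ x y) ⟨
      x * (y + 𝟏) + (y + 𝟏) ∎

  *-comm : ∀ x y → x * y ≡ y * x
  *-comm x = ind (con x *ᶠ v0 ≈ᶠ v0 *ᶠ con x)
    (trans (*-0 x) (sym (*-zeroˡ x)))
    λ y h → trans (*-succ x y) (trans (cong (_+ x) h) (sym (*-succˡ y x)))

  *-assoc : ∀ x y z → (x * y) * z ≡ x * (y * z)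
  *-assoc x y = ind ((con x *ᶠ con y) *ᶠ v0 ≈ᶠ con x *ᶠ (con y *ᶠ v0))
    (trans (*-0 _) (sym (trans (cong (x *_) (*-0 y)) (*-0 x))))
    λ z h → trans (*-succ _ z) (trans (cong (_+ x * y) h)
      (trans (sym (*-distribˡ x _ _)) (cong (x *_) (sym (*-succ y z)))))

  *-identityʳ : ∀ x → x * 𝟏 ≡ x
  *-identityʳ x = begin
    x * 𝟏       ≡⟨ cong (x *_) (+-identityˡ 𝟏) ⟨
    x * (𝟎 + 𝟏) ≡⟨ *-succ x 𝟎 ⟩
    x * 𝟎 + x   ≡⟨ cong (_+ x) (*-0 x) ⟩
    𝟎 + x       ≡⟨ +-identityˡ x ⟩
    x           ∎

  commutativeSemiring : CommutativeSemiring 0ℓ 0ℓ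
  commutativeSemiring = record
    { Carrier = C ; _≈_ = _≡_ ; _+_ = _+_ ; _*_ = _*_ ; 0# = 𝟎 ; 1# = 𝟏
    ; isCommutativeSemiring = isCommutativeSemiringʳ record
      { +-isCommutativeMonoid = record
        { isMonoid = record
          { isSemigroup = record
            { isMagma = record { isEquivalence = isEquivalence ; ∙-cong = cong₂ _+_ }
            ; assoc = +-assoc }
          ; identity = +-identityˡ , +-0 }
        ; comm = +-comm }
      ; *-isCommutativeMonoid = record
        { isMonoid = record
          { isSemigroup = record
            { isMagma = record { isEquivalence = isEquivalence ; ∙-cong = cong₂ _*_ }
            ; assoc = *-assoc }
          ; identity = (λ x → trans (*-comm 𝟏 x) (*-identityʳ x)) , *-identityʳ }
        ; comm = *-comm }
      ; distribˡ = *-distribˡ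
      ; zeroʳ = *-0 } }

  open Solver commutativeSemiring public using (solve; _:=_; _:+_; _:*_) renaming (con to :con)

  :1 :0 : ∀ {n} → Solver.Polynomial commutativeSemiring n
  :1 = :con 1
  :0 = :con 0

  opaque
    +-cancelʳ : ∀ z x y → x + z ≡ y + z → x ≡ y
    +-cancelʳ z x y = ind (con x +ᶠ v0 ≈ᶠ con y +ᶠ v0 ⊃ con x ≈ᶠ con y)
      (λ p → trans (sym (+-0 x)) (trans p (+-0 y)))
      (λ z h p → h (succ-inj _ _ (trans (sym (+-succ x z)) (trans p (+-succ y z))))) z

    +-cancelˡ : ∀ z x y → z + x ≡ z + y → x ≡ y
    +-cancelˡ z x y p = +-cancelʳ z x y (trans (+-comm x z) (trans p (+-comm z y)))

    zero-or-suc : ∀ x → x ≡ 𝟎 ⊎ Σ[ y ∈ C ] x ≡ y + 𝟏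
    zero-or-suc = ind (v0 ≈ᶠ 0ᶠ ∨ ∃ᶠ (v1 ≈ᶠ v0 +ᶠ 1ᶠ)) (inj₁ refl) (λ x _ → inj₂ (x , refl))

    +-conicalʳ : ∀ x y → x + y ≡ 𝟎 → y ≡ 𝟎
    +-conicalʳ x y p with zero-or-suc y
    ... | inj₁ q = q
    ... | inj₂ (z , refl) = ⊥-elim (succ≢0 (x + z) (trans (sym (+-succ x z)) p))

  infix 4 _<_
  -- Agrees with `M ⊨ x < y` because the order is discrete (`⊨<-intro`, `⊨<-elim`); in this form
  -- strict inequalities are handled by the lemmas on `≤`.
  _<_ : C → C → Set
  x < y = x + 𝟏 ≤ y

  infix 7 _<ᶠ_
  _<ᶠ_ : ∀ {n} → Tm n → Tm n → Fm n
  s <ᶠ t = s +ᶠ 1ᶠ ≤ᶠ t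

  opaque
    ≤-intro : ∀ {x y} z → x + z ≡ y → x ≤ y
    ≤-intro z p = proj₂ (≤-def _ _) (z , p)

    ≤-elim : ∀ {x y} → x ≤ y → Σ[ z ∈ C ] x + z ≡ y
    ≤-elim = proj₁ (≤-def _ _)

    ≤-refl : ∀ {x} → x ≤ x
    ≤-refl = ≤-intro 𝟎 (+-0 _)

    ≤-reflexive : ∀ {x y} → x ≡ y → x ≤ y
    ≤-reflexive refl = ≤-refl

    ≤-trans : ∀ {x y z} → x ≤ y → y ≤ z → x ≤ z
    ≤-trans {x} p q with ≤-elim p | ≤-elim q
    ... | a , refl | b , refl = ≤-intro (a + b) (sym (+-assoc x a b))

    ≤-antisym : ∀ {x y} → x ≤ y → y ≤ x → x ≡ y
    ≤-antisym {x} p q with ≤-elim p | ≤-elim q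
    ... | a , refl | b , s with +-conicalʳ b a (trans (+-comm b a)
          (+-cancelˡ x _ _ (trans (sym (+-assoc x a b)) (trans s (sym (+-0 x))))))
    ... | refl = sym (+-0 x)

    0≤ : ∀ x → 𝟎 ≤ x
    0≤ x = ≤-intro x (+-identityˡ x)

    ≤+ʳ : ∀ x y → x ≤ x + y
    ≤+ʳ x y = ≤-intro y refl

    ≤+ˡ : ∀ x y → x ≤ y + x
    ≤+ˡ x y = ≤-intro y (+-comm x y)

    <⇒≤ : ∀ {x y} → x < y → x ≤ y
    <⇒≤ p = ≤-trans (≤+ʳ _ _) p

    <-irrefl : ∀ {x} → ¬ x < x
    <-irrefl {x} p with ≤-elim p
    ... | z , q = succ≢0 z (+-cancelˡ x _ _
      (trans (trans (solve 2 (λ x z → x :+ (z :+ :1) := (x :+ :1) :+ z) refl x z) q) (sym (+-0 x))))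

    n<n+1 : ∀ {x} → x < x + 𝟏
    n<n+1 = ≤-refl

    +-mono-≤ : ∀ {x y u v} → x ≤ y → u ≤ v → x + u ≤ y + v
    +-mono-≤ {x} {y} {u} {v} p q with ≤-elim p | ≤-elim q
    ... | a , refl | b , refl =
      ≤-intro (a + b) (solve 4 (λ x u a b → x :+ u :+ (a :+ b) := x :+ a :+ (u :+ b)) refl x u a b)

    *-mono-≤ : ∀ {x y u v} → x ≤ y → u ≤ v → x * u ≤ y * v
    *-mono-≤ {x} {y} {u} {v} p q with ≤-elim p | ≤-elim q
    ... | a , refl | b , refl = ≤-intro (x * b + a * (u + b))
      (solve 4 (λ x u a b → x :* u :+ (x :* b :+ a :* (u :+ b)) := (x :+ a) :* (u :+ b)) refl x u a b)

    suc-mono-≤ : ∀ {x y} → x ≤ y → x + 𝟏 ≤ y + 𝟏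
    suc-mono-≤ p = +-mono-≤ p ≤-refl

    +-cancelˡ-≤ : ∀ z {x y} → z + x ≤ z + y → x ≤ y
    +-cancelˡ-≤ z {x} {y} p with ≤-elim p
    ... | a , q = ≤-intro a (+-cancelˡ z _ _ (trans (sym (+-assoc z x a)) q))

    +-cancelʳ-≤ : ∀ z {x y} → x + z ≤ y + z → x ≤ y
    +-cancelʳ-≤ z p = +-cancelˡ-≤ z (subst₂ _≤_ (+-comm _ z) (+-comm _ z) p)

    <suc⇒≤ : ∀ {x y} → x < y + 𝟏 → x ≤ y
    <suc⇒≤ = +-cancelʳ-≤ 𝟏

    ≤-<-trans : ∀ {x y z} → x ≤ y → y < z → x < z
    ≤-<-trans p q = ≤-trans (suc-mono-≤ p) q

    <-≤-trans : ∀ {x y z} → x < y → y ≤ z → x < z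
    <-≤-trans = ≤-trans

    ≤⇒≯ : ∀ {x y} → x ≤ y → ¬ y < x
    ≤⇒≯ p q = <-irrefl (≤-<-trans p q)

    <⇒≢ : ∀ {x y} → x < y → x ≢ y
    <⇒≢ p refl = <-irrefl p

    ≤⇒≡⊎< : ∀ {x y} → x ≤ y → x ≡ y ⊎ x < y
    ≤⇒≡⊎< {x} p with ≤-elim p
    ... | z , refl with zero-or-suc z
    ... | inj₁ refl = inj₁ (sym (+-0 x))
    ... | inj₂ (w , refl) = inj₂ (≤-intro w (solve 2 (λ x w → x :+ :1 :+ w := x :+ (w :+ :1)) refl x w))

    ≤-<-connex : ∀ x y → x ≤ y ⊎ y < x
    ≤-<-connex x y = ind (v0 ≤ᶠ con y ∨ con y <ᶠ v0) (inj₁ (0≤ y)) step x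
      where
      step : ∀ x → x ≤ y ⊎ y < x → x + 𝟏 ≤ y ⊎ y < x + 𝟏
      step x (inj₂ q) = inj₂ (≤-trans q (≤+ʳ _ _))
      step x (inj₁ p) with ≤⇒≡⊎< p
      ... | inj₁ refl = inj₂ ≤-refl
      ... | inj₂ q    = inj₁ q

  ≮⇒≥ : ∀ {x y} → ¬ x < y → y ≤ x
  ≮⇒≥ {x} {y} h with ≤-<-connex y x
  ... | inj₁ p = p
  ... | inj₂ q = ⊥-elim (h q)

  ≰⇒> : ∀ {x y} → ¬ x ≤ y → y < x
  ≰⇒> {x} {y} h with ≤-<-connex x y
  ... | inj₁ p = ⊥-elim (h p)
  ... | inj₂ q = q

  ⊨<-intro : ∀ {x y} → x < y → M ⊨ x < y
  ⊨<-intro p = <⇒≤ p , <⇒≢ p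

  ⊨<-elim : ∀ {x y} → M ⊨ x < y → x < y
  ⊨<-elim (p , n) with ≤⇒≡⊎< p
  ... | inj₁ q = ⊥-elim (n q)
  ... | inj₂ q = q

  ≮0 : ∀ {x} → ¬ x < 𝟎
  ≮0 p = ≤⇒≯ (0≤ _) p

  0<suc : ∀ {x} → 𝟎 < x + 𝟏
  0<suc = suc-mono-≤ (0≤ _)

  <suc⇒<⊎≡ : ∀ {x y} → x < y + 𝟏 → x < y ⊎ x ≡ y
  <suc⇒<⊎≡ p with ≤⇒≡⊎< (<suc⇒≤ p)
  ... | inj₁ q = inj₂ q
  ... | inj₂ q = inj₁ q

  <-cmp : ∀ x y → x < y ⊎ x ≡ y ⊎ y < x
  <-cmp x y with ≤-<-connex x y
  ... | inj₂ q = inj₂ (inj₂ q)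
  ... | inj₁ p with ≤⇒≡⊎< p
  ... | inj₁ q = inj₂ (inj₁ q)
  ... | inj₂ q = inj₁ q

  -- The least number principle and minimisation

  Least : (C → Set) → C → Set
  Least P m = P m × (∀ y → P y → m ≤ y)

  -- If there were no least element, induction on x would show that nothing below x satisfies P.
  least : ∀ {P} → Def₁ P → ∀ a → P a → Σ[ m ∈ C ] Least P m
  least {P} d a p = by-contradiction λ n →
    ind (∀ᶠ (v0 <ᶠ v1 ⊃ ¬ᶠ rel₁ d v0)) (λ y q _ → ≮0 q) (step n) (a + 𝟏) a n<n+1 p
    where
    step : ¬ (Σ[ m ∈ C ] Least P m) → ∀ x → (∀ y → y < x → ¬ P y) → ∀ y → y < x + 𝟏 → ¬ P y
    step n x h y q p with <suc⇒<⊎≡ q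
    ... | inj₁ r    = h y r p
    ... | inj₂ refl = n (x , p , λ z pz → ≮⇒≥ (λ r → h z r pz))

  Least-unique : ∀ {P x y} → Least P x → Least P y → x ≡ y
  Least-unique (p , h) (q , k) = ≤-antisym (h _ q) (k _ p)

  -- The value is 𝟎 if P has no least element.
  μ : (C → Set) → C
  μ P with em {Σ[ m ∈ C ] Least P m}
  ... | yes (m , _) = m
  ... | no _        = 𝟎

  μ-cases : ∀ P → Least P (μ P) ⊎ (¬ (Σ[ m ∈ C ] Least P m) × μ P ≡ 𝟎)
  μ-cases P with em {Σ[ m ∈ C ] Least P m}
  ... | yes (m , p) = inj₁ p
  ... | no n        = inj₂ (n , refl)

  μ-≡ : ∀ {P m} → Least P m → μ P ≡ m
  μ-≡ {P} l with μ-cases P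
  ... | inj₁ l′      = Least-unique l′ l
  ... | inj₂ (n , _) = ⊥-elim (n (_ , l))

  μ-least : ∀ {P} → Def₁ P → ∀ a → P a → Least P (μ P)
  μ-least {P} d a p with μ-cases P
  ... | inj₁ l       = l
  ... | inj₂ (n , _) = ⊥-elim (n (least d a p))

  μ-Fun₁ : ∀ {Q : C → C → Set} → Def₂ Q → Fun₁ (λ x → μ (λ y → Q y x))
  μ-Fun₁ {Q} d = ⟨ Def-resp (λ w → equiv (w zero) (w (suc zero))) (definable graph) ⟩
    where
    graph : Fm 2
    -- The second disjunct accounts for the default value, so that the graph is total.
    graph = (rel₂ d v0 v1 ∧ ∀ᶠ (rel₂ d v0 v2 ⊃ v1 ≤ᶠ v0))
      ∨ (¬ᶠ ∃ᶠ (rel₂ d v0 v2 ∧ ∀ᶠ (rel₂ d v0 v3 ⊃ v1 ≤ᶠ v0)) ∧ v0 ≈ᶠ 0ᶠ)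
    equiv : ∀ y x → (Least (λ y → Q y x) y ⊎ (¬ (Σ[ m ∈ C ] Least (λ y → Q y x) m) × y ≡ 𝟎)) ⟺
                    (y ≡ μ (λ y → Q y x))
    equiv y x = to , (λ { refl → μ-cases (λ y → Q y x) })
      where
      to : _ → _
      to (inj₁ l) = sym (μ-≡ l)
      to (inj₂ (n , refl)) with μ-cases (λ y → Q y x)
      ... | inj₁ l = ⊥-elim (n (_ , l))
      ... | inj₂ (_ , q) = sym q

  Least-of-unique : ∀ {P m} → P m → (∀ y → P y → y ≡ m) → Least P m
  Least-of-unique p h = p , λ y q → ≤-reflexive (sym (h y q))

  -- Division with remainder and the β-function

  Remᶠ : ∀ {n} → Tm n → Tm n → Tm n → Fm n
  Remᶠ = rel₃ {P = Rem M} ⟨ definable (∃ᶠ (v1 ≈ᶠ v0 *ᶠ v2 +ᶠ v3 ∧ v3 ≤ᶠ v2 ∧ ¬ᶠ (v3 ≈ᶠ v2))) ⟩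

  modulus : C → C → C
  modulus d i = 𝟏 + (i + 𝟏) * d

  βᶠ : ∀ {n} → Tm n → Tm n → Tm n → Tm n → Fm n
  βᶠ c d i u = Remᶠ c (1ᶠ +ᶠ (i +ᶠ 1ᶠ) *ᶠ d) u

  opaque
    Rem-intro : ∀ {a m r} q → a ≡ q * m + r → r < m → Rem M a m r
    Rem-intro q p l = q , p , ⊨<-intro l

  opaque
    Rem-exists : ∀ {m} → 𝟎 < m → ∀ a → Σ[ r ∈ C ] Rem M a m r
    Rem-exists {m} m>0 = ind (∃ᶠ (Remᶠ v1 (con m) v0))
      (𝟎 , Rem-intro 𝟎 (solve 1 (λ m → :0 := :0 :* m :+ :0) refl m) m>0) step
      where
      step : ∀ a → Σ[ r ∈ C ] Rem M a m r → Σ[ r ∈ C ] Rem M (a + 𝟏) m r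
      step a (r , q , refl , l) with ≤⇒≡⊎< (⊨<-elim l)
      ... | inj₁ e = 𝟎 , Rem-intro (q + 𝟏)
        (trans (+-assoc _ _ _) (trans (cong (q * m +_) e)
          (solve 2 (λ q m → q :* m :+ m := (q :+ :1) :* m :+ :0) refl q m))) m>0
      ... | inj₂ e = r + 𝟏 , Rem-intro q (+-assoc _ _ _) e

  opaque
    quotient-unique : ∀ {q q′ m r r′} → r < m → r′ < m → q * m + r ≡ q′ * m + r′ → q ≡ q′
    quotient-unique {q} {q′} {m} {r} {r′} l l′ e = case (<-cmp q q′)
      where
      absurd : ∀ {q q′ r r′} → q < q′ → r < m → q * m + r ≡ q′ * m + r′ → ⊥
      absurd {q} {q′} {r} {r′} h l e with ≤-elim h
      ... | t , refl = <⇒≢ (<-≤-trans l (≤-trans (≤+ʳ m (t * m)) (≤+ʳ _ r′)))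
        (+-cancelˡ (q * m) _ _ (trans e
          (solve 4 (λ q m t r → (q :+ :1 :+ t) :* m :+ r := q :* m :+ (m :+ t :* m :+ r)) refl q m t r′)))
      case : q < q′ ⊎ q ≡ q′ ⊎ q′ < q → q ≡ q′
      case (inj₁ h)        = ⊥-elim (absurd h l e)
      case (inj₂ (inj₁ h)) = h
      case (inj₂ (inj₂ h)) = ⊥-elim (absurd h l′ (sym e))

  opaque
    Rem-unique : ∀ {a m r r′} → Rem M a m r → Rem M a m r′ → r ≡ r′
    Rem-unique {m = m} {r} {r′} (q , p , l) (q′ , p′ , l′) = +-cancelˡ (q * m) _ _
      (trans (trans (sym p) p′) (cong (λ z → z * m + r′)
        (sym (quotient-unique (⊨<-elim l) (⊨<-elim l′) (trans (sym p) p′)))))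

  opaque
    β-exists : ∀ c d i → Σ[ u ∈ C ] β≡ M c d i u
    β-exists c d i = Rem-exists (≤-trans (≤-reflexive (+-identityˡ 𝟏)) (≤+ʳ _ _)) c

    β-unique : ∀ {c d i u u′} → β≡ M c d i u → β≡ M c d i u′ → u ≡ u′
    β-unique = Rem-unique

  opaque
    -- Stands in for x!, which is not yet available as a function: recursion in M rests on the
    -- β-lemma, which in turn rests on this number.
    common-multiple : ∀ x → Σ[ d ∈ C ] 𝟎 < d × (∀ i → i < x → Σ[ k ∈ C ] d ≡ (i + 𝟏) * k)
    common-multiple = ind (∃ᶠ (0ᶠ <ᶠ v0 ∧ ∀ᶠ (v0 <ᶠ v2 ⊃ ∃ᶠ (v2 ≈ᶠ (v1 +ᶠ 1ᶠ) *ᶠ v0))))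
      (𝟏 , ≤-reflexive (+-identityˡ 𝟏) , λ i p → ⊥-elim (≮0 p)) step
      where
      step : ∀ x → Σ[ d ∈ C ] 𝟎 < d × (∀ i → i < x → Σ[ k ∈ C ] d ≡ (i + 𝟏) * k) →
             Σ[ d ∈ C ] 𝟎 < d × (∀ i → i < x + 𝟏 → Σ[ k ∈ C ] d ≡ (i + 𝟏) * k)
      step x (d , d>0 , h) = (x + 𝟏) * d ,
          ≤-trans d>0 (≤-intro (x * d) (solve 2 (λ x d → d :+ x :* d := (x :+ :1) :* d) refl x d)) , k
        where
        k : ∀ i → i < x + 𝟏 → Σ[ k ∈ C ] (x + 𝟏) * d ≡ (i + 𝟏) * k
        k i p with <suc⇒<⊎≡ p
        ... | inj₂ refl = d , refl
        ... | inj₁ q with h i q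
        ... | k , e = (x + 𝟏) * k , trans (cong ((x + 𝟏) *_) e)
          (solve 3 (λ x i k → x :* (i :* k) := i :* (x :* k)) refl (x + 𝟏) (i + 𝟏) k)

  opaque
    bounded-below : ∀ {f} → Fun₁ f → ∀ x → Σ[ b ∈ C ] (∀ i → i < x → f i ≤ b)
    bounded-below {f} fd = ind (∃ᶠ (∀ᶠ (v0 <ᶠ v2 ⊃ fun₁ fd v0 ≤ᶠ v1)))
      (𝟎 , λ i p → ⊥-elim (≮0 p)) step
      where
      step : ∀ x → Σ[ b ∈ C ] (∀ i → i < x → f i ≤ b) → Σ[ b ∈ C ] (∀ i → i < x + 𝟏 → f i ≤ b)
      step x (b , h) = b + f x , λ i p → k i (<suc⇒<⊎≡ p)
        where
        k : ∀ i → i < x ⊎ i ≡ x → f i ≤ b + f x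
        k i (inj₁ q)    = ≤-trans (h i q) (≤+ʳ _ _)
        k i (inj₂ refl) = ≤+ˡ _ _

  opaque
    -- Writing n = g + h for the larger index and T = n d, one has
    -- (1 + h d) n³ w d = (1 + T)(n³ w d) − T³ and T³ ≡ −1 modulo 1 + T.
    modulus-inverse : ∀ g h w t → (g + h) * (g * w) ≡ t + 𝟏 →
      (𝟏 + h * (g * w)) * ((g + h) * (g + h) * (g + h) * w * (g * w)) ≡
      𝟏 + ((g + h) * (g + h) * h * w * (g * w) + t) * (𝟏 + (g + h) * (g * w))
    modulus-inverse g h w t e = +-cancelʳ (n * d) _ _ (begin
      (𝟏 + h * d) * (n * n * n * w * d) + n * d
        ≡⟨ solve 3 (λ g h w → let n = g :+ h ; d = g :* w in
             (:1 :+ h :* d) :* (n :* n :* n :* w :* d) :+ n :* d :=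
             n :* n :* h :* w :* d :* (:1 :+ n :* d) :+ n :* d :+ n :* d :* (n :* d)) refl g h w ⟩
      a * (𝟏 + n * d) + n * d + n * d * (n * d)
        ≡⟨ cong₂ (λ p q → a * (𝟏 + n * d) + p + q * (n * d)) e e ⟩
      a * (𝟏 + n * d) + (t + 𝟏) + (t + 𝟏) * (n * d)
        ≡⟨ solve 3 (λ a t s → a :* (:1 :+ s) :+ (t :+ :1) :+ (t :+ :1) :* s :=
             :1 :+ (a :+ t) :* (:1 :+ s) :+ s) refl a t (n * d) ⟩
      𝟏 + (a + t) * (𝟏 + n * d) + n * d ∎)
      where
      n d a : C
      n = g + h
      d = g * w
      a = n * n * h * w * d

  Invertible : C → C → Set
  Invertible m a = Σ[ b ∈ C ] Σ[ q ∈ C ] a * b ≡ 𝟏 + q * m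

  opaque
    Invertible-* : ∀ {m a a′} → Invertible m a → Invertible m a′ → Invertible m (a * a′)
    Invertible-* {m} {a} {a′} (b , q , e) (b′ , q′ , e′) =
      b * b′ , q + q′ + q * (q′ * m) , (begin
        a * a′ * (b * b′)
          ≡⟨ solve 4 (λ a a′ b b′ → a :* a′ :* (b :* b′) := a :* b :* (a′ :* b′)) refl a a′ b b′ ⟩
        a * b * (a′ * b′)
          ≡⟨ cong₂ _*_ e e′ ⟩
        (𝟏 + q * m) * (𝟏 + q′ * m)
          ≡⟨ solve 3 (λ q q′ m → (:1 :+ q :* m) :* (:1 :+ q′ :* m) :=
               :1 :+ (q :+ q′ :+ q :* (q′ :* m)) :* m) refl q q′ m ⟩
        𝟏 + (q + q′ + q * (q′ * m)) * m ∎)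

  opaque
    -- The usual argument takes a common prime divisor; here `modulus-inverse` gives an explicit
    -- inverse, with g the difference of the indices and g + h = j + 1.
    moduli-coprime : ∀ {d i j} → 𝟎 < d → i < j → (∀ k → k < j → Σ[ w ∈ C ] d ≡ (k + 𝟏) * w) →
                     Invertible (modulus d j) (modulus d i)
    moduli-coprime {d} {i} d>0 i<j div with ≤-elim i<j
    -- The difference of the indices is `k + 𝟏` and k < j, so it divides d.
    ... | k , refl with div k (≤-intro i (solve 2 (λ k i → k :+ :1 :+ i := i :+ :1 :+ k) refl k i))
    ... | w , refl with ≤-elim d>0
    ... | d′ , e = (g + h) * (g + h) * (g + h) * w * (g * w) ,
        (g + h) * (g + h) * h * w * (g * w) + t ,
        trans (modulus-inverse g h w t
                 (trans (solve 3 (λ k i d → (k :+ :1 :+ (i :+ :1)) :* d := (k :+ :1 :+ i) :* d :+ d) refl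
                          k i (g * w))
                 (trans (cong ((k + 𝟏 + i) * (g * w) +_)
                          (trans (sym e) (solve 1 (λ x → :0 :+ :1 :+ x := x :+ :1) refl d′)))
                 (sym (+-assoc _ _ _)))))
              (cong (λ x → 𝟏 + ((g + h) * (g + h) * h * w * (g * w) + t) * (𝟏 + x * (g * w)))
                 (solve 2 (λ k i → k :+ :1 :+ (i :+ :1) := i :+ :1 :+ k :+ :1) refl k i))
      where
      g h t : C
      g = k + 𝟏
      h = i + 𝟏
      t = (k + 𝟏 + i) * (g * w) + d′

  opaque
    -- The witness p is the product of the first k moduli, described by the two properties that the
    -- Chinese remainder theorem uses. Invertibility is preserved because each new factor is coprime
    -- to the modulus of j.
    moduli-product : ∀ {d j} → 𝟎 < d → (∀ k → k < j → Σ[ w ∈ C ] d ≡ (k + 𝟏) * w) → ∀ k → k ≤ j →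
      Σ[ p ∈ C ] (∀ i → i < k → Σ[ t ∈ C ] p ≡ t * modulus d i) × Invertible (modulus d j) p
    moduli-product {d} {j} d>0 div = ind
      (v0 ≤ᶠ con j ⊃ ∃ᶠ (∀ᶠ (v0 <ᶠ v2 ⊃ ∃ᶠ (v2 ≈ᶠ v0 *ᶠ (1ᶠ +ᶠ (v1 +ᶠ 1ᶠ) *ᶠ con d)))
        ∧ ∃ᶠ (∃ᶠ (v2 *ᶠ v1 ≈ᶠ 1ᶠ +ᶠ v0 *ᶠ con (modulus d j)))))
      (λ _ → 𝟏 , (λ i p → ⊥-elim (≮0 p)) , 𝟏 , 𝟎 ,
        solve 1 (λ m → :1 :* :1 := :1 :+ :0 :* m) refl (modulus d j))
      step
      where
      Q : C → Set
      Q k = k ≤ j → Σ[ p ∈ C ] (∀ i → i < k → Σ[ t ∈ C ] p ≡ t * modulus d i) × Invertible (modulus d j) p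
      step : ∀ k → Q k → Q (k + 𝟏)
      step k h l with h (<⇒≤ l)
      ... | p , dvd , inv = p * modulus d k , dvd′ ,
          Invertible-* {modulus d j} {p} {modulus d k} inv (moduli-coprime d>0 l div)
        where
        dvd′ : ∀ i → i < k + 𝟏 → Σ[ t ∈ C ] p * modulus d k ≡ t * modulus d i
        dvd′ i q with <suc⇒<⊎≡ q
        ... | inj₂ refl = p , refl
        ... | inj₁ q′ with dvd i q′
        ... | t , e = t * modulus d k , trans (cong (_* modulus d k) e)
          (solve 3 (λ t a b → t :* a :* b := t :* b :* a) refl t (modulus d i) (modulus d k))

  opaque
    -- Remainders are prescribed one index at a time. Adding a multiple of the product p of the
    -- earlier moduli leaves the earlier remainders alone, and as p is invertible for the next
    -- modulus, a suitable multiple gives the new one.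
    chinese-remainder : ∀ {f} → Fun₁ f → ∀ {d x} → 𝟎 < d → (∀ i → i < x → Σ[ w ∈ C ] d ≡ (i + 𝟏) * w) →
      (∀ i → i < x → f i ≤ d) → ∀ k → k ≤ x → Σ[ c ∈ C ] (∀ i → i < k → β≡ M c d i (f i))
    chinese-remainder {f} fd {d} {x} d>0 div small = ind
      (v0 ≤ᶠ con x ⊃ ∃ᶠ (∀ᶠ (v0 <ᶠ v2 ⊃ βᶠ v1 (con d) v0 (fun₁ fd v0))))
      (λ _ → 𝟎 , λ i p → ⊥-elim (≮0 p)) step
      where
      Q : C → Set
      Q k = k ≤ x → Σ[ c ∈ C ] (∀ i → i < k → β≡ M c d i (f i))
      step : ∀ k → Q k → Q (k + 𝟏)
      step k h l with h (<⇒≤ l) | moduli-product d>0 (λ i p → div i (≤-trans p (<⇒≤ l))) k ≤-refl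
      ... | c , cβ | p , dvd , b , q , inv with β-exists c d k
      ... | r , q₀ , cr , r<m with ≤-elim (proj₁ r<m)
      -- Here `s` is the modulus minus r, which replaces subtraction: since p · b is 1 modulo m, the
      -- new number is congruent to r + (f k + s), hence to f k.
      ... | s , rs = c + p * (b * (f k + s)) , cβ′
        where
        m : C
        m = modulus d k
        old : ∀ i → β≡ M c d i (f i) → Σ[ t ∈ C ] p ≡ t * modulus d i →
              β≡ M (c + p * (b * (f k + s))) d i (f i)
        old i (q , e , u) (t , e′) = q + t * (b * (f k + s)) ,
          trans (cong₂ (λ c p → c + p * (b * (f k + s))) e e′)
            (solve 5 (λ q t m z u → q :* m :+ u :+ t :* m :* z := (q :+ t :* z) :* m :+ u) refl
              q t (modulus d i) (b * (f k + s)) (f i)) , u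
        new : β≡ M (c + p * (b * (f k + s))) d k (f k)
        new = Rem-intro (q₀ + 𝟏 + q * (f k + s)) (begin
            c + p * (b * (f k + s))
              ≡⟨ cong₂ _+_ cr (trans (sym (*-assoc p b _)) (cong (_* (f k + s)) inv)) ⟩
            q₀ * m + r + (𝟏 + q * m) * (f k + s)
              ≡⟨ solve 6 (λ q₀ m r q u s → q₀ :* m :+ r :+ (:1 :+ q :* m) :* (u :+ s) :=
                   q₀ :* m :+ (r :+ s) :+ q :* m :* (u :+ s) :+ u) refl q₀ m r q (f k) s ⟩
            q₀ * m + (r + s) + q * m * (f k + s) + f k
              ≡⟨ cong (λ y → q₀ * m + y + q * m * (f k + s) + f k) rs ⟩
            q₀ * m + m + q * m * (f k + s) + f k
              ≡⟨ cong (_+ f k) (solve 4 (λ q₀ m q z → q₀ :* m :+ m :+ q :* m :* z :=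
                   (q₀ :+ :1 :+ q :* z) :* m) refl q₀ m q (f k + s)) ⟩
            (q₀ + 𝟏 + q * (f k + s)) * m + f k ∎)
          (≤-trans (suc-mono-≤ (small k l)) (≤-intro (k * d)
            (solve 2 (λ d k → d :+ :1 :+ k :* d := :1 :+ (k :+ :1) :* d) refl d k)))
        cβ′ : ∀ i → i < k + 𝟏 → β≡ M (c + p * (b * (f k + s))) d i (f i)
        cβ′ i j with <suc⇒<⊎≡ j
        ... | inj₂ refl = new
        ... | inj₁ j′   = old i (cβ i j′) (dvd i j′)

  opaque
    β-lemma : ∀ {f} → Fun₁ f → ∀ x → Σ[ c ∈ C ] Σ[ d ∈ C ] (∀ i → i < x → β≡ M c d i (f i))
    β-lemma {f} fd x =
      let d , d>0 , div = common-multiple x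
          b , bnd = bounded-below fd x
          d′ , e = ≤-elim d>0
          -- The factor `b + 𝟏` makes this number at least as large as all values of f below x, and
          -- it remains a common multiple.
          c , h = chinese-remainder fd {d * (b + 𝟏)} {x}
            (≤-trans d>0 (≤-intro (d * b) (solve 2 (λ d b → d :+ d :* b := d :* (b :+ :1)) refl d b)))
            (λ i p → proj₁ (div i p) * (b + 𝟏) ,
              trans (cong (_* (b + 𝟏)) (proj₂ (div i p))) (*-assoc _ _ _))
            (λ i p → ≤-trans (bnd i p) (≤-intro (𝟏 + d′ * (b + 𝟏))
              (trans (solve 2 (λ b d → b :+ (:1 :+ d :* (b :+ :1)) := (:0 :+ :1 :+ d) :* (b :+ :1)) refl b d′)
                     (cong (_* (b + 𝟏)) e))))
            x ≤-refl
      in c , d * (b + 𝟏) , h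

  -- Primitive recursion in M

  module Recursion (z : C) (g : C → C → C → C) (gd : Fun₃ g) where

    -- The shape copies that of `Exp≡`, so that for z = 𝟏 and doubling the two agree by definition.
    -- The parameter p is passed along unchanged.
    Computes : C → C → C → Set
    Computes p x y = Σ[ c ∈ C ] Σ[ d ∈ C ]
      β≡ M c d 𝟎 z ×
      (∀ i → M ⊨ i < x → ∀ u → β≡ M c d i u → β≡ M c d (i + 𝟏) (g p i u)) ×
      β≡ M c d x y

    Computesᶠ : ∀ {n} → Tm n → Tm n → Tm n → Fm n
    Computesᶠ = rel₃ {P = Computes} ⟨ definable (∃ᶠ (∃ᶠ (
      βᶠ v1 v0 0ᶠ (con z) ∧
      (∀ᶠ (v0 ≤ᶠ v4 ∧ ¬ᶠ (v0 ≈ᶠ v4) ⊃ ∀ᶠ (βᶠ v3 v2 v1 v0 ⊃ βᶠ v3 v2 (v1 +ᶠ 1ᶠ) (fun₃ gd v4 v1 v0))) ∧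
      βᶠ v1 v0 v3 v4)))) ⟩

    opaque
      computes-unique : ∀ {p x y y′} → Computes p x y → Computes p x y′ → y ≡ y′
      computes-unique {p} {x} {y} {y′} (c , d , s , h , k) (c′ , d′ , s′ , h′ , k′) =
        ind (v0 ≤ᶠ con x ⊃ ∀ᶠ (∀ᶠ (βᶠ (con c) (con d) v2 v1 ⊃ βᶠ (con c′) (con d′) v2 v0 ⊃ v1 ≈ᶠ v0)))
          (λ _ u u′ b b′ → trans (β-unique b s) (β-unique s′ b′)) step x ≤-refl y y′ k k′
        where
        Q : C → Set
        Q i = i ≤ x → ∀ u u′ → β≡ M c d i u → β≡ M c′ d′ i u′ → u ≡ u′
        step : ∀ i → Q i → Q (i + 𝟏)
        step i ih l u u′ b b′ with β-exists c d i | β-exists c′ d′ i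
        ... | w , bw | w′ , bw′ with ih (<⇒≤ l) w w′ bw bw′
        ... | refl = trans (β-unique b (h i (⊨<-intro l) w bw)) (β-unique (h′ i (⊨<-intro l) w bw′) b′)

    opaque
      -- A β-code cannot be lengthened in place. The old values followed by the new one form a
      -- definable function `f`, and this is coded afresh by the β-lemma.
      computes-extend : ∀ {p x y} → Computes p x y → Computes p (x + 𝟏) (g p x y)
      computes-extend {p} {x} {y} (c , d , s , h , k) = extended
        where
        F : C → C → Set
        F u i = (i ≤ x → β≡ M c d i u) × (x < i → u ≡ g p x y)
        f : C → C
        f i = μ (λ u → F u i)
        fd : Fun₁ f
        fd = μ-Fun₁ {Q = F} ⟨ definable ((v1 ≤ᶠ con x ⊃ βᶠ (con c) (con d) v1 v0)
                                       ∧ (con x <ᶠ v1 ⊃ v0 ≈ᶠ con (g p x y))) ⟩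
        f-old : ∀ {i u} → i ≤ x → β≡ M c d i u → f i ≡ u
        f-old l b = μ-≡ (Least-of-unique ((λ _ → b) , λ q → ⊥-elim (≤⇒≯ l q))
                          (λ u′ q → β-unique (proj₁ q l) b))
        f-new : f (x + 𝟏) ≡ g p x y
        f-new = μ-≡ (Least-of-unique ((λ q → ⊥-elim (≤⇒≯ q n<n+1)) , λ _ → refl)
                      (λ u′ q → proj₂ q n<n+1))
        extended : Computes p (x + 𝟏) (g p x y)
        -- The length is x + 2 because the indices 0, ..., x + 1 all occur.
        extended with β-lemma fd (x + 𝟏 + 𝟏)
        ... | c′ , d′ , b = c′ , d′ ,
            subst (β≡ M c′ d′ 𝟎) (f-old (0≤ x) s) (b 𝟎 0<suc) ,
            (λ i l u bu → next-value i (⊨<-elim l) u bu) ,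
            subst (β≡ M c′ d′ (x + 𝟏)) f-new (b (x + 𝟏) n<n+1)
          where
          next-value : ∀ i → i < x + 𝟏 → ∀ u → β≡ M c′ d′ i u → β≡ M c′ d′ (i + 𝟏) (g p i u)
          next-value i l u bu with β-exists c d i | β-unique bu (b i (≤-trans l (≤+ʳ _ _)))
          ... | w , bw | refl = subst (β≡ M c′ d′ (i + 𝟏)) (goal (<suc⇒<⊎≡ l)) (b (i + 𝟏) (suc-mono-≤ l))
            where
            goal : i < x ⊎ i ≡ x → f (i + 𝟏) ≡ g p i (f i)
            goal (inj₁ q)    = trans (f-old q (h i (⊨<-intro q) w bw))
                                     (cong (g p i) (sym (f-old (<⇒≤ q) bw)))
            goal (inj₂ refl) = trans f-new (cong (g p x) (sym (f-old ≤-refl k)))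

    opaque
      computes-exists : ∀ p x → Σ[ y ∈ C ] Computes p x y
      computes-exists p = ind (∃ᶠ (Computesᶠ (con p) v1 v0)) base
        (λ x (y , q) → g p x y , computes-extend q)
        where
        base : Σ[ y ∈ C ] Computes p 𝟎 y
        base with β-lemma {λ _ → z} ⟨ definableₜ (con z) ⟩ 𝟏
        ... | c , d , b = z , c , d , b 𝟎 l , (λ i q → ⊥-elim (≮0 (⊨<-elim q))) , b 𝟎 l
          where
          l : 𝟎 < 𝟏
          l = ≤-reflexive (+-identityˡ 𝟏)

    rec : C → C → C
    rec p x = proj₁ (computes-exists p x)

    rec-computes : ∀ p x → Computes p x (rec p x)
    rec-computes p x = proj₂ (computes-exists p x)

    rec-suc : ∀ p x → rec p (x + 𝟏) ≡ g p x (rec p x)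
    rec-suc p x = computes-unique (rec-computes p (x + 𝟏)) (computes-extend (rec-computes p x))

    rec-zero : ∀ p → rec p 𝟎 ≡ z
    rec-zero p with rec-computes p 𝟎
    ... | c , d , s , _ , k = β-unique k s

    rec-Fun₂ : Fun₂ rec
    rec-Fun₂ = ⟨ Def-resp (λ w → (λ q → computes-unique q (rec-computes _ _)) ,
                                 (λ { e → subst (Computes _ _) (sym e) (rec-computes _ _) }))
                          (definable {3} (Computesᶠ v1 v2 v0)) ⟩

  -- Powers of two and binary codes of sets

  module Exp = Recursion 𝟏 (λ _ _ u → u + u) ⟨ definableₜ (v2 +ᶠ v2) ⟩

  exp : C → C
  exp = Exp.rec 𝟎

  expᶠ : ∀ {n} → Tm n → Tm n
  expᶠ = fun₂ Exp.rec-Fun₂ 0ᶠ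

  Exp-exists : ∀ x → Exp≡ M x (exp x)
  Exp-exists = Exp.rec-computes 𝟎

  Exp-unique : ∀ {x y} → Exp≡ M x y → y ≡ exp x
  Exp-unique p = Exp.computes-unique {𝟎} p (Exp-exists _)

  exp-zero : exp 𝟎 ≡ 𝟏
  exp-zero = Exp.rec-zero 𝟎

  exp-suc : ∀ x → exp (x + 𝟏) ≡ exp x + exp x
  exp-suc = Exp.rec-suc 𝟎

  opaque
    exp-+ : ∀ x y → exp (x + y) ≡ exp x * exp y
    exp-+ x = ind (expᶠ (con x +ᶠ v0) ≈ᶠ expᶠ (con x) *ᶠ expᶠ v0)
      (trans (cong exp (+-0 x)) (sym (trans (cong (exp x *_) exp-zero) (*-identityʳ _))))
      λ y h → begin
        exp (x + (y + 𝟏))             ≡⟨ cong exp (+-succ x y) ⟩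
        exp (x + y + 𝟏)               ≡⟨ exp-suc _ ⟩
        exp (x + y) + exp (x + y)     ≡⟨ cong₂ _+_ h h ⟩
        exp x * exp y + exp x * exp y ≡⟨ *-distribˡ _ _ _ ⟨
        exp x * (exp y + exp y)       ≡⟨ cong (exp x *_) (exp-suc y) ⟨
        exp x * exp (y + 𝟏)           ∎

    n<exp : ∀ x → x < exp x
    n<exp = ind (v0 <ᶠ expᶠ v0) (≤-reflexive (trans (+-identityˡ 𝟏) (sym exp-zero)))
      λ x h → subst (x + 𝟏 <_) (sym (exp-suc x)) (+-mono-≤ h (≤-trans (≤+ˡ 𝟏 x) h))

  exp>0 : ∀ x → 𝟎 < exp x
  exp>0 x = ≤-<-trans (0≤ x) (n<exp x)

  -- Ackermann's membership relation: b codes the set of the positions at which its binary digit is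
  -- 1.
  Bit : C → C → Set
  Bit i b = Σ[ r ∈ C ] Rem M b (exp (i + 𝟏)) r × exp i ≤ r

  Bitᶠ : ∀ {n} → Tm n → Tm n → Fm n
  Bitᶠ = rel₂ {P = Bit} ⟨ definable (∃ᶠ (Remᶠ v2 (expᶠ (v1 +ᶠ 1ᶠ)) v0 ∧ expᶠ v1 ≤ᶠ v0)) ⟩

  opaque
    Rem-+-multiple : ∀ {b m r} k → Rem M b m r → Rem M (b + k * m) m r
    Rem-+-multiple {b} {m} {r} k (q , e , l) = q + k ,
      trans (cong (_+ k * m) e)
        (solve 4 (λ q m r k → q :* m :+ r :+ k :* m := (q :+ k) :* m :+ r) refl q m r k) , l

    Rem-small : ∀ {b m} → b < m → Rem M b m b
    Rem-small {b} {m} l = Rem-intro 𝟎 (solve 2 (λ b m → b := :0 :* m :+ b) refl b m) l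

  opaque
    +exp<exp-suc : ∀ {a b} → b < exp a → b + exp a < exp (a + 𝟏)
    +exp<exp-suc {a} {b} l = subst (b + exp a <_) (sym (exp-suc a))
      (≤-trans (≤-reflexive (solve 2 (λ b e → b :+ e :+ :1 := b :+ :1 :+ e) refl b (exp a)))
               (+-mono-≤ l ≤-refl))

  opaque
    Bit-+-multiple : ∀ {i b} k → Bit i b ⟺ Bit i (b + k * exp (i + 𝟏))
    Bit-+-multiple {i} {b} k =
      (λ (r , p , q) → r , Rem-+-multiple k p , q) ,
      (λ (r , p , q) → let r′ , p′ = Rem-exists (exp>0 (i + 𝟏)) b
                       in r′ , p′ , subst (exp i ≤_) (Rem-unique p (Rem-+-multiple k p′)) q)

    Bit-+exp : ∀ {i a b} → i < a → Bit i b ⟺ Bit i (b + exp a)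
    Bit-+exp {i} {a} {b} i<a with ≤-elim i<a
    ... | t , refl = subst (λ z → Bit i b ⟺ Bit i (b + z))
      (trans (*-comm (exp t) _) (sym (exp-+ (i + 𝟏) t))) (Bit-+-multiple (exp t))

    Bit-top : ∀ {a b} → b < exp a → Bit a (b + exp a)
    Bit-top {a} {b} l = b + exp a ,
      Rem-small (+exp<exp-suc l) , ≤+ˡ _ _

    ¬Bit-top : ∀ {a b} → b < exp a → ¬ Bit a b
    ¬Bit-top {a} {b} l (r , p , q) = ≤⇒≯ q (subst (_< exp a)
      (Rem-unique (Rem-small (<-≤-trans l (subst (exp a ≤_) (sym (exp-suc a)) (≤+ʳ _ _)))) p) l)

  opaque
    -- Comprehension below a, by induction on a: the power 2^a is added exactly when P holds at a,
    -- which leaves the lower digits unchanged.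
    code-exists : ∀ {P} → Def₁ P → ∀ a → Σ[ b ∈ C ] b < exp a × (∀ i → i < a → P i ⟺ Bit i b)
    code-exists {P} d = ind
      (∃ᶠ (v0 <ᶠ expᶠ v1 ∧ ∀ᶠ (v0 <ᶠ v2 ⊃ (rel₁ d v0 ⊃ Bitᶠ v0 v1) ∧ (Bitᶠ v0 v1 ⊃ rel₁ d v0))))
      (𝟎 , exp>0 𝟎 , λ i p → ⊥-elim (≮0 p)) step
      where
      Q : C → Set
      Q a = Σ[ b ∈ C ] b < exp a × (∀ i → i < a → P i ⟺ Bit i b)
      step : ∀ a → Q a → Q (a + 𝟏)
      step a (b , l , h) with em {P a}
      ... | yes p = b + exp a ,
          +exp<exp-suc l ,
          λ i q → bits i (<suc⇒<⊎≡ q)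
        where
        bits : ∀ i → i < a ⊎ i ≡ a → P i ⟺ Bit i (b + exp a)
        bits i (inj₁ q)    = ⟺-trans (h i q) (Bit-+exp q)
        bits i (inj₂ refl) = (λ _ → Bit-top l) , (λ _ → p)
      ... | no ¬p = b , <-≤-trans l (subst (exp a ≤_) (sym (exp-suc a)) (≤+ʳ _ _)) ,
          λ i q → bits i (<suc⇒<⊎≡ q)
        where
        bits : ∀ i → i < a ⊎ i ≡ a → P i ⟺ Bit i b
        bits i (inj₁ q)    = h i q
        bits i (inj₂ refl) = (λ p → ⊥-elim (¬p p)) , (λ q → ⊥-elim (¬Bit-top l q))

  SameBits : C → C → C → Set
  SameBits a b b′ = ∀ i → i < a → Bit i b ⟺ Bit i b′

  private
    split : ∀ a b → b < exp (a + 𝟏) → b < exp a ⊎ Σ[ c ∈ C ] (b ≡ c + exp a × c < exp a)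
    split a b l with ≤-<-connex (exp a) b
    ... | inj₂ q = inj₁ q
    ... | inj₁ q with ≤-elim q
    ... | c , refl = inj₂ (c , +-comm _ _ , +-cancelˡ-≤ (exp a)
      (≤-trans (≤-reflexive (sym (+-assoc _ _ _))) (≤-trans l (≤-reflexive (exp-suc a)))))

  opaque
    -- The digit in position a tells whether a number below 2^(a+1) is already below 2^a or is 2^a
    -- plus such a number. Removing it changes both numbers, so they are quantified inside the
    -- induction formula.
    code-unique : ∀ a b b′ → b < exp a → b′ < exp a → SameBits a b b′ → b ≡ b′
    code-unique = ind (∀ᶠ (∀ᶠ (v1 <ᶠ expᶠ v2 ⊃ v0 <ᶠ expᶠ v2 ⊃
        ∀ᶠ (v0 <ᶠ v3 ⊃ (Bitᶠ v0 v2 ⊃ Bitᶠ v0 v1) ∧ (Bitᶠ v0 v1 ⊃ Bitᶠ v0 v2)) ⊃ v1 ≈ᶠ v0)))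
      (λ b b′ l l′ _ → trans (zero′ l) (sym (zero′ l′))) step
      where
      zero′ : ∀ {b} → b < exp 𝟎 → b ≡ 𝟎
      zero′ {b} l = ≤-antisym (<suc⇒≤ (≤-trans l (≤-reflexive (trans exp-zero (sym (+-identityˡ 𝟏)))))) (0≤ b)
      Q : C → Set
      Q a = ∀ b b′ → b < exp a → b′ < exp a → SameBits a b b′ → b ≡ b′
      step : ∀ a → Q a → Q (a + 𝟏)
      step a ih b b′ l l′ same with split a b l | split a b′ l′
      ... | inj₁ q | inj₁ q′ = ih b b′ q q′ (λ i p → same i (<-≤-trans p (≤+ʳ _ _)))
      ... | inj₁ q | inj₂ (c , refl , q′) = ⊥-elim (¬Bit-top q (proj₂ (same a n<n+1) (Bit-top q′)))
      ... | inj₂ (c , refl , q) | inj₁ q′ = ⊥-elim (¬Bit-top q′ (proj₁ (same a n<n+1) (Bit-top q)))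
      ... | inj₂ (c , refl , q) | inj₂ (c′ , refl , q′) = cong (_+ exp a) (ih c c′ q q′ (λ i p →
        ⟺-trans (Bit-+exp p) (⟺-trans (same i (<-≤-trans p (≤+ʳ _ _))) (⟺-sym (Bit-+exp p)))))

  -- Counting and the pigeonhole principle

  χ : (C → C → Set) → C → C → C
  χ Q p x with em {Q p x}
  ... | yes _ = 𝟏
  ... | no _  = 𝟎

  χ-cases : ∀ Q p x → (Q p x × χ Q p x ≡ 𝟏) ⊎ ((¬ Q p x) × χ Q p x ≡ 𝟎)
  χ-cases Q p x with em {Q p x}
  ... | yes q = inj₁ (q , refl)
  ... | no ¬q = inj₂ (¬q , refl)

  opaque
    χ-yes : ∀ {Q p x} → Q p x → χ Q p x ≡ 𝟏
    χ-yes {Q} {p} {x} q with χ-cases Q p x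
    ... | inj₁ (_ , e)  = e
    ... | inj₂ (¬q , _) = ⊥-elim (¬q q)

    χ-no : ∀ {Q p x} → ¬ Q p x → χ Q p x ≡ 𝟎
    χ-no {Q} {p} {x} ¬q with χ-cases Q p x
    ... | inj₁ (q , _) = ⊥-elim (¬q q)
    ... | inj₂ (_ , e) = e

    χ-Fun₂ : ∀ {Q} → Def₂ Q → Fun₂ (χ Q)
    χ-Fun₂ {Q} d = ⟨ Def-resp (λ w → equiv (w zero) (w (suc zero)) (w (suc (suc zero))))
      (definable ((rel₂ d v1 v2 ∧ v0 ≈ᶠ 1ᶠ) ∨ (¬ᶠ rel₂ d v1 v2 ∧ v0 ≈ᶠ 0ᶠ))) ⟩
      where
      equiv : ∀ y p x → ((Q p x × y ≡ 𝟏) ⊎ ((¬ Q p x) × y ≡ 𝟎)) ⟺ (y ≡ χ Q p x)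
      equiv y p x = (λ { (inj₁ (q , refl)) → sym (χ-yes q) ; (inj₂ (q , refl)) → sym (χ-no q) }) ,
                    (λ { refl → χ-cases Q p x })

  InjectiveBelow : (C → C) → C → Set
  InjectiveBelow f e = ∀ x y → x < e → y < e → f x ≡ f y → x ≡ y

  module Count (Q : C → C → Set) (Qd : Def₂ Q) where

    private
      module R = Recursion 𝟎 (λ p x u → u + χ Q p x) ⟨ definableₜ (v2 +ᶠ fun₂ (χ-Fun₂ Qd) v0 v1) ⟩

    -- The number of z < x with Q p z.
    count : C → C → C
    count = R.rec

    countᶠ : ∀ {n} → Tm n → Tm n → Tm n
    countᶠ = fun₂ R.rec-Fun₂

    count-zero : ∀ p → count p 𝟎 ≡ 𝟎
    count-zero = R.rec-zero

    count-yes : ∀ {p x} → Q p x → count p (x + 𝟏) ≡ count p x + 𝟏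
    count-yes {p} {x} q = trans (R.rec-suc p x) (cong (count p x +_) (χ-yes q))

    count-no : ∀ {p x} → ¬ Q p x → count p (x + 𝟏) ≡ count p x
    count-no {p} {x} q = trans (R.rec-suc p x) (trans (cong (count p x +_) (χ-no q)) (+-0 _))

    opaque
      count-mono : ∀ p {x y} → x ≤ y → count p x ≤ count p y
      count-mono p {x} h with ≤-elim h
      ... | z , refl = ind (countᶠ (con p) (con x) ≤ᶠ countᶠ (con p) (con x +ᶠ v0))
        (≤-reflexive (cong (count p) (sym (+-0 x))))
        (λ z ih → ≤-trans ih (≤-trans (≤+ʳ _ _) (≤-reflexive
          (trans (sym (R.rec-suc p (x + z))) (cong (count p) (sym (+-succ x z))))))) z

    opaque
      count-injective : ∀ {p x y} → Q p x → Q p y → count p x ≡ count p y → x ≡ y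
      count-injective {p} {x} {y} qx qy e with <-cmp x y
      ... | inj₂ (inj₁ h) = h
      ... | inj₁ h        = ⊥-elim (<⇒≢ (≤-trans (≤-reflexive (sym (count-yes qx))) (count-mono p h)) e)
      ... | inj₂ (inj₂ h) = ⊥-elim (<⇒≢ (≤-trans (≤-reflexive (sym (count-yes qy))) (count-mono p h)) (sym e))

    opaque
      count-attains : ∀ p j y → j < count p y → Σ[ x ∈ C ] x < y × Q p x × count p x ≡ j
      count-attains p j = ind
        (con j <ᶠ countᶠ (con p) v0 ⊃ ∃ᶠ (v0 <ᶠ v1 ∧ rel₂ Qd (con p) v0 ∧ countᶠ (con p) v0 ≈ᶠ con j))
        (λ l → ⊥-elim (≮0 (subst (j <_) (count-zero p) l))) step
        where
        P : C → Set
        P y = j < count p y → Σ[ x ∈ C ] x < y × Q p x × count p x ≡ j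
        wk : ∀ {y} → Σ[ x ∈ C ] x < y × Q p x × count p x ≡ j →
             Σ[ x ∈ C ] x < y + 𝟏 × Q p x × count p x ≡ j
        wk (x , a , b) = x , <-≤-trans a (≤+ʳ _ _) , b
        step : ∀ y → P y → P (y + 𝟏)
        step y ih l with em {Q p y}
        ... | no ¬q = wk (ih (subst (j <_) (count-no ¬q) l))
        ... | yes q with <suc⇒<⊎≡ (subst (j <_) (count-yes q) l)
        ... | inj₁ l′   = wk (ih l′)
        ... | inj₂ refl = y , n<n+1 , q , refl

    opaque
      -- `t j` is the element of the set with exactly j elements of the set before it, so `count p`
      -- is a left inverse of t.
      enumerate : ∀ p y k → k ≤ count p y → Σ[ t ∈ (C → C) ] Fun₁ t ×
        (∀ j → j < k → t j < y × Q p (t j)) × InjectiveBelow t k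
      enumerate p y k k≤ = t , td , (λ j l → let a , b , _ = spec j l in a , b) ,
        (λ j j′ l l′ e → trans (sym (proj₂ (proj₂ (spec j l))))
                          (trans (cong (count p) e) (proj₂ (proj₂ (spec j′ l′)))))
        where
        t : C → C
        t j = μ (λ x → x < y × Q p x × count p x ≡ j)
        Td : Def₂ (λ x j → x < y × Q p x × count p x ≡ j)
        Td = ⟨ definable (v0 <ᶠ con y ∧ rel₂ Qd (con p) v0 ∧ countᶠ (con p) v0 ≈ᶠ v1) ⟩
        td : Fun₁ t
        td = μ-Fun₁ Td
        spec : ∀ j → j < k → t j < y × Q p (t j) × count p (t j) ≡ j
        spec j l = let x , h = count-attains p j y (<-≤-trans l k≤) in
          proj₁ (μ-least {λ x → x < y × Q p x × count p x ≡ j}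
            ⟨ definable (v0 <ᶠ con y ∧ rel₂ Qd (con p) v0 ∧ countᶠ (con p) v0 ≈ᶠ con j) ⟩ x h)

  opaque
    -- Count the x < e with f x < v. For an injective f this number grows by at most one when v
    -- does, so it is at most v; for v = w it is e.
    pigeonhole : ∀ {f e w} → Fun₁ f → InjectiveBelow f e → (∀ x → x < e → f x < w) → e ≤ w
    pigeonhole {f} {e} {w} fd inj bnd = subst (_≤ w) (all e ≤-refl) (few w)
      where
      open Count (λ v x → f x < v) ⟨ definable (fun₁ fd v1 <ᶠ v0) ⟩
      all : ∀ y → y ≤ e → count w y ≡ y
      all = ind (v0 ≤ᶠ con e ⊃ countᶠ (con w) v0 ≈ᶠ v0) (λ _ → count-zero w)
        (λ y ih l → trans (count-yes (bnd y l)) (cong (_+ 𝟏) (ih (<⇒≤ l))))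
      -- The second alternative remembers the x at which the count grew, so that another x with f x
      -- = v would contradict injectivity.
      Q : C → C → Set
      Q v y = y ≤ e → count (v + 𝟏) y ≤ count v y ⊎
              Σ[ x ∈ C ] (x < y × f x ≡ v × count (v + 𝟏) y ≤ count v y + 𝟏)
      compare-step : ∀ v y → Q v y → Q v (y + 𝟏)
      compare-step v y ih l with <-cmp (f y) v | ih (<⇒≤ l)
      ... | inj₁ a | inj₁ h = inj₁
        (subst₂ _≤_ (sym (count-yes (<-≤-trans a (≤+ʳ _ _)))) (sym (count-yes a)) (suc-mono-≤ h))
      ... | inj₁ a | inj₂ (x , p , q , h) = inj₂ (x , <-≤-trans p (≤+ʳ _ _) , q ,
        subst₂ (λ s t → s ≤ t + 𝟏) (sym (count-yes (<-≤-trans a (≤+ʳ _ _)))) (sym (count-yes a))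
          (suc-mono-≤ h))
      ... | inj₂ (inj₁ refl) | inj₁ h = inj₂ (y , n<n+1 , refl ,
        subst₂ (λ s t → s ≤ t + 𝟏) (sym (count-yes n<n+1)) (sym (count-no <-irrefl)) (suc-mono-≤ h))
      ... | inj₂ (inj₁ refl) | inj₂ (x , p , q , h) = ⊥-elim (<⇒≢ p (inj x y (<-≤-trans p (<⇒≤ l)) l q))
      ... | inj₂ (inj₂ a) | inj₁ h = inj₁ (subst₂ _≤_ (sym (count-no (λ b → ≤⇒≯ (<suc⇒≤ b) a)))
        (sym (count-no (λ b → ≤⇒≯ (<⇒≤ b) a))) h)
      ... | inj₂ (inj₂ a) | inj₂ (x , p , q , h) = inj₂ (x , <-≤-trans p (≤+ʳ _ _) , q ,
        subst₂ (λ s t → s ≤ t + 𝟏) (sym (count-no (λ b → ≤⇒≯ (<suc⇒≤ b) a)))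
          (sym (count-no (λ b → ≤⇒≯ (<⇒≤ b) a))) h)
      compare : ∀ v y → Q v y
      compare v = ind (v0 ≤ᶠ con e ⊃ countᶠ (con v +ᶠ 1ᶠ) v0 ≤ᶠ countᶠ (con v) v0 ∨
          ∃ᶠ (v0 <ᶠ v1 ∧ fun₁ fd v0 ≈ᶠ con v ∧ countᶠ (con v +ᶠ 1ᶠ) v1 ≤ᶠ countᶠ (con v) v1 +ᶠ 1ᶠ))
        (λ _ → inj₁ (≤-reflexive (trans (count-zero _) (sym (count-zero _))))) (compare-step v)
      none : ∀ y → count 𝟎 y ≡ 𝟎
      none = ind (countᶠ 0ᶠ v0 ≈ᶠ 0ᶠ) (count-zero _) (λ y ih → trans (count-no ≮0) ih)
      few : ∀ v → count v e ≤ v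
      few = ind (countᶠ v0 (con e) ≤ᶠ v0) (≤-reflexive (none e)) step
        where
        step : ∀ v → count v e ≤ v → count (v + 𝟏) e ≤ v + 𝟏
        step v ih with compare v e ≤-refl
        ... | inj₁ h = ≤-trans h (≤-trans ih (≤+ʳ _ _))
        ... | inj₂ (_ , _ , _ , h) = ≤-trans h (suc-mono-≤ ih)

  -- Large homogeneous subsets

  -- A subset of [0, e) with k elements, given by a definable listing rather than by a code; passing
  -- to a subset is then composition of functions.
  record Selection (e k : C) : Set where
    field
      at     : C → C
      at-def : Fun₁ at
      at<    : ∀ j → j < k → at j < e
      at-inj : InjectiveBelow at k

  open Selection public

  ConstantOn : ∀ {e k} → (C → C) → Selection e k → Set
  ConstantOn {k = k} f s = Σ[ v ∈ C ] (∀ j → j < k → f (at s j) ≡ v)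

  opaque
    -- Let the rank of x be its position in its own fibre. If some rank reaches k, the first k
    -- elements of that fibre are selected. Otherwise x ↦ f x · k + rank x maps [0, e) injectively
    -- into [0, w · k), by uniqueness of division by k.
    large-fibre : ∀ {f e w k} → Fun₁ f → (∀ x → x < e → f x < w) → w * k < e →
                  Σ[ s ∈ Selection e k ] ConstantOn f s
    large-fibre {f} {e} {w} {k} fd bnd big = result
      where
      open Count (λ v z → f z ≡ v) ⟨ definable (fun₁ fd v1 ≈ᶠ v0) ⟩
      rank : C → C
      rank x = count (f x) x
      h : C → C
      h x = f x * k + rank x
      hd : Fun₁ h
      hd = ⟨ definableₜ (fun₁ fd v0 *ᶠ con k +ᶠ countᶠ (fun₁ fd v0) v0) ⟩
      module _ (rank< : ∀ x → x < e → rank x < k) where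
        h-bnd : ∀ x → x < e → h x < w * k
        h-bnd x l = ≤-trans (≤-reflexive (+-assoc _ _ _))
          (≤-trans (+-mono-≤ (≤-refl {f x * k}) (rank< x l))
          (≤-trans (≤-reflexive (sym (*-succˡ (f x) k))) (*-mono-≤ (bnd x l) ≤-refl)))
        h-inj : InjectiveBelow h e
        h-inj x y l l′ p = count-injective refl (sym q)
          (trans (+-cancelˡ (f x * k) _ _ (trans p (cong (λ z → z * k + rank y) (sym q))))
                 (cong (λ z → count z y) (sym q)))
          where
          q : f x ≡ f y
          q = quotient-unique (rank< x l) (rank< y l′) p
      result : Σ[ s ∈ Selection e k ] ConstantOn f s
      result with em {Σ[ x ∈ C ] x < e × k ≤ rank x}
      ... | yes (x , l , h) = let t , td , a , b = enumerate (f x) x k h in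
        record { at = t ; at-def = td ; at-inj = b
               ; at< = λ j p → <-≤-trans (proj₁ (a j p)) (<⇒≤ l) } ,
        f x , λ j p → proj₂ (a j p)
      ... | no n = ⊥-elim (≤⇒≯ (pigeonhole hd (h-inj rank<) (h-bnd rank<)) big)
        where
        rank< : ∀ x → x < e → rank x < k
        rank< x l = ≰⇒> (λ q → n (x , l , q))

  -- Count the first occurrences of the values of f: if there are many, f is injective on them, and
  -- otherwise f has a large fibre.
  opaque
    constant-or-injective : ∀ {f e k} → Fun₁ f → k * k < e →
      Σ[ s ∈ Selection e k ] (ConstantOn f s ⊎ InjectiveBelow (λ j → f (at s j)) k)
    constant-or-injective {f} {e} {k} fd big = result
      where
      first : C → C
      first x = μ (λ y → f y ≡ f x)
      first-def : Fun₁ first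
      first-def = μ-Fun₁ {Q = λ y x → f y ≡ f x} ⟨ definable (fun₁ fd v0 ≈ᶠ fun₁ fd v1) ⟩
      first-spec : ∀ x → f (first x) ≡ f x × first x ≤ x
      first-spec x = let a , b = μ-least ⟨ definable (fun₁ fd v0 ≈ᶠ con (f x)) ⟩ x refl in a , b x refl
      first-cong : ∀ {x y} → f x ≡ f y → first x ≡ first y
      first-cong e = cong (λ v → μ (λ y → f y ≡ v)) e
      open Count (λ _ y → first y ≡ y) ⟨ definable (fun₁ first-def v1 ≈ᶠ v1) ⟩
      class : C → C
      class x = count 𝟎 (first x)
      class-def : Fun₁ class
      class-def = ⟨ definableₜ (countᶠ 0ᶠ (fun₁ first-def v0)) ⟩
      class-injective : ∀ {x y} → class x ≡ class y → f x ≡ f y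
      class-injective {x} {y} e = trans (sym (proj₁ (first-spec x))) (trans
        (cong f (count-injective (first-cong (proj₁ (first-spec x))) (first-cong (proj₁ (first-spec y))) e))
        (proj₁ (first-spec y)))
      result : Σ[ s ∈ Selection e k ] (ConstantOn f s ⊎ InjectiveBelow (λ j → f (at s j)) k)
      result with em {Σ[ x ∈ C ] x < e × k ≤ class x}
      ... | yes (x , l , h) = let t , td , a , b = enumerate 𝟎 (first x) k h in
        record { at = t ; at-def = td ; at-inj = b
               ; at< = λ j p → <-≤-trans (proj₁ (a j p)) (≤-trans (proj₂ (first-spec x)) (<⇒≤ l)) } ,
        inj₂ (λ i j p q r → b i j p q
          (trans (sym (proj₂ (a i p))) (trans (first-cong r) (proj₂ (a j q)))))
      ... | no n = let s , v , h = large-fibre class-def (λ x l → ≰⇒> (λ q → n (x , l , q))) big in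
        s , inj₁ (f (at s 𝟎) , λ j p → class-injective (trans (h j p) (sym (h 𝟎 (≤-<-trans (0≤ j) p)))))

  opaque
    -- Split [0, e) by whether r ≤ f x; this costs the factor 2. The part that is kept has r + 1
    -- elements and cannot be mapped injectively below r, so it is the one with the large values.
    large-values : ∀ {f e r} → Fun₁ f → InjectiveBelow f e → (𝟏 + 𝟏) * (r + 𝟏) < e →
      Σ[ s ∈ Selection e (r + 𝟏) ] (∀ j → j < r + 𝟏 → r ≤ f (at s j))
    large-values {f} {e} {r} fd inj big = s , large
      where
      Q : C → C → Set
      Q r x = r ≤ f x
      Qd : Def₂ Q
      Qd = ⟨ definable (v0 ≤ᶠ fun₁ fd v1) ⟩
      χ≤1 : ∀ x → χ Q r x ≤ 𝟏
      χ≤1 x with χ-cases Q r x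
      ... | inj₁ (_ , e) = ≤-reflexive e
      ... | inj₂ (_ , e) = ≤-trans (≤-reflexive e) (0≤ 𝟏)
      fibre : Σ[ s ∈ Selection e (r + 𝟏) ] ConstantOn (χ Q r) s
      fibre = large-fibre ⟨ definableₜ (fun₂ (χ-Fun₂ Qd) (con r) v0) ⟩ (λ x _ → suc-mono-≤ (χ≤1 x)) big
      s : Selection e (r + 𝟏)
      s = proj₁ fibre
      large : ∀ j → j < r + 𝟏 → r ≤ f (at s j)
      large j l with χ-cases Q r (at s j)
      ... | inj₁ (q , _) = q
      ... | inj₂ (¬q , e₀) = ⊥-elim (<-irrefl (pigeonhole {λ j → f (at s j)} {r + 𝟏} {r}
          ⟨ definableₜ (fun₁ fd (fun₁ (at-def s) v0)) ⟩
          (λ i j p q h → at-inj s i j p q (inj _ _ (at< s i p) (at< s j q) h))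
          (λ i p → ≰⇒> (λ h → succ≢0 𝟎 (trans (+-identityˡ 𝟏) (trans (sym (χ-yes {Q} h))
            (trans (proj₂ (proj₂ fibre) i p) (trans (sym (proj₂ (proj₂ fibre) j l)) e₀))))))))

  opaque
    -- The binary code of the section at x is a definable function of x with values below 2^a, so
    -- one of its fibres is large.
    uniform-below : ∀ {φ : C → C → Set} {e a k} → Def₂ φ → exp a * k < e →
      Σ[ s ∈ Selection e k ] Σ[ b ∈ C ] (∀ j → j < k → ∀ y → y < a → φ y (at s j) ⟺ Bit y b)
    uniform-below {φ} {e} {a} {k} φd big =
      let s , b , h = large-fibre hd (λ x _ → proj₁ (spec x)) big in
      s , b , λ j l y q → subst (λ z → φ y (at s j) ⟺ Bit y z) (h j l) (proj₂ (spec (at s j)) y q)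
      where
      Code : C → C → Set
      Code b x = b < exp a × (∀ y → y < a → φ y x ⟺ Bit y b)
      h : C → C
      h x = μ (λ b → Code b x)
      hd : Fun₁ h
      hd = μ-Fun₁ {Q = Code} ⟨ definable (v0 <ᶠ expᶠ (con a) ∧
        ∀ᶠ (v0 <ᶠ con a ⊃ (rel₂ φd v0 v2 ⊃ Bitᶠ v0 v1) ∧ (Bitᶠ v0 v1 ⊃ rel₂ φd v0 v2))) ⟩
      spec : ∀ x → Code (h x) x
      spec x = let b , p = code-exists ⟨ definable (rel₂ φd v0 (con x)) ⟩ a in
        proj₁ (μ-least {λ b → Code b x} ⟨ definable (v0 <ᶠ expᶠ (con a) ∧
          ∀ᶠ (v0 <ᶠ con a ⊃ (rel₂ φd v0 (con x) ⊃ Bitᶠ v0 v1) ∧ (Bitᶠ v0 v1 ⊃ rel₂ φd v0 (con x)))) ⟩ b p)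

-- Cuts, overspill, and exponential closure from an extension

module Cuts (em : ExcludedMiddle 0ℓ) (M : Structure) (pa : IsPA M)
            (en : ℕ → Carrier M) (surj : ∀ m → Σ[ k ∈ ℕ ] en k ≡ m)
            (J : Pred M) (cut : IsCut M J) where

  open Arithmetic em M pa en surj public
  open IsCut cut public

  Sat-Def : ∀ {k} (φ : Formula k) → Def k (Sat M φ)
  Sat-Def φ = raw toℕ φ , λ v → raw-sat M φ (λ i → sym (▷-var v en i))

  Sat-params-Def₁ : ∀ {n} (φ : Formula (suc n)) (ρ : Fin n → C) → Def₁ (λ a → Sat M φ (a ∷ ρ))
  Sat-params-Def₁ φ ρ = ⟨ raw (0 ∷ (λ j → suc (proj₁ (surj (ρ j))))) φ ,
    (λ v → raw-sat M φ (λ { zero → refl ; (suc j) → sym (proj₂ (surj (ρ j))) })) ⟩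

  J-down : ∀ {x y} → x ≤ y → J y → J x
  J-down {x} {y} p j with zero-or-suc x
  ... | inj₁ refl       = zero∈
  ... | inj₂ (z , refl) = closed z y (≤-trans (≤+ʳ _ _) p) j

  J-suc : ∀ {x} → J x → J (x + 𝟏)
  J-suc j = closed _ _ ≤-refl j

  J<∉J : ∀ {x y} → J x → ¬ J y → x < y
  J<∉J j n = ≰⇒> (λ p → n (J-down p j))

  ∉J-up : ∀ {x y} → ¬ J x → x ≤ y → ¬ J y
  ∉J-up n p j = n (J-down p j)

  -- Otherwise P and J coincide; then P is closed under successor, induction gives all of M, and J
  -- would not be proper.
  overspill : ∀ {P} → Def₁ P → (∀ x → J x → P x) → Σ[ a ∈ C ] ((¬ J a) × P a)
  overspill {P} d h = by-contradiction λ n →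
    let P⇒J : ∀ x → P x → J x
        P⇒J x p = by-contradiction (λ ¬j → n (x , ¬j , p))
        c , ¬Jc = ≠M
    in ¬Jc (P⇒J c (ind (rel₁ d v0) (h 𝟎 zero∈) (λ x p → h (x + 𝟏) (J-suc (P⇒J x p))) c))

  -- An element b of N below 2^a is determined by its bits, and these are coded in M.
  module _ {N : Structure} (f : ElemEmb M N) where

    emb-≤ : ∀ {x y} → x ≤ y ⟺ Structure._≤_ N (emb f x) (emb f y)
    emb-≤ {x} {y} = elem f (var zero ≼ var (suc zero)) (x ∷ y ∷ [])

    emb-injective : ∀ {x y} → emb f x ≡ emb f y → x ≡ y
    emb-injective {x} {y} = proj₂ (elem f (var zero ≐ var (suc zero)) (x ∷ y ∷ []))

    private
      bitR : RFormula
      bitR = proj₁ (definable {2} (Bitᶠ v0 v1))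

      BitN : Carrier N → Carrier N → Set
      BitN i b = RSat N bitR (i ◂ b ◂ (emb f ∘ en))

      Bit⟺BitN : ∀ i b → Bit i b ⟺ BitN (emb f i) (emb f b)
      Bit⟺BitN i b = ⟺-trans (proj₂ (definable {2} (Bitᶠ v0 v1)) (i ∷ b ∷ []))
        (⟺-trans (elem-raw f bitR (i ◂ b ◂ en))
          (RSat-cong N bitR (λ { 0 → refl ; 1 → refl ; (suc (suc k)) → refl })))

      -- Under the three quantifiers of `ext` the variables are the position, b′, b, a and 2^a, in
      -- this order; the parameters therefore start at 5.
      bit₁ bit₂ : RFormula
      bit₁ = ren (0 ◂ 2 ◂ (5 ℕ.+_)) bitR
      bit₂ = ren (0 ◂ 1 ◂ (5 ℕ.+_)) bitR

      bit₁-sat : ∀ K ρ i b′ b → RSat K bit₁ (i ◂ b′ ◂ b ◂ ρ) ⟺ RSat K bitR (i ◂ b ◂ (λ k → ρ (2 ℕ.+ k)))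
      bit₁-sat K ρ i b′ b = ren-sat K bitR (λ { 0 → refl ; 1 → refl ; (suc (suc k)) → refl })

      bit₂-sat : ∀ K ρ i b′ b → RSat K bit₂ (i ◂ b′ ◂ b ◂ ρ) ⟺ RSat K bitR (i ◂ b′ ◂ (λ k → ρ (2 ℕ.+ k)))
      bit₂-sat K ρ i b′ b = ren-sat K bitR (λ { 0 → refl ; 1 → refl ; (suc (suc k)) → refl })

      Bit⟺bitR : ∀ i b → Bit i b ⟺ RSat M bitR (i ◂ b ◂ en)
      Bit⟺bitR i b = proj₂ (definable {2} (Bitᶠ v0 v1)) (i ∷ b ∷ [])

      -- The free variables 0 and 1 stand for a and 2^a.
      ext : RFormula
      ext = r∀ (r∀ (
        rvar 1 r≼ rvar 3 r⇒ r¬ (rvar 1 r≐ rvar 3) r⇒ rvar 0 r≼ rvar 3 r⇒ r¬ (rvar 0 r≐ rvar 3) r⇒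
        r∀ (rvar 0 r≼ rvar 3 r⇒ r¬ (rvar 0 r≐ rvar 3) r⇒ bit₁ r⇒ bit₂) r⇒
        r∀ (rvar 0 r≼ rvar 3 r⇒ r¬ (rvar 0 r≐ rvar 3) r⇒ bit₂ r⇒ bit₁) r⇒
        rvar 1 r≐ rvar 0))

      ext-M : ∀ a → RSat M ext (a ◂ exp a ◂ en)
      ext-M a b b′ p p′ q q′ h h′ = code-unique a b b′ (⊨<-elim (p , p′)) (⊨<-elim (q , q′)) same
        where
        ρ : ℕ → C
        ρ = a ◂ exp a ◂ en
        in₁ : ∀ i → Bit i b ⟺ RSat M bit₁ (i ◂ b′ ◂ b ◂ ρ)
        in₁ i = ⟺-trans (Bit⟺bitR i b) (⟺-sym (bit₁-sat M ρ i b′ b))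
        in₂ : ∀ i → Bit i b′ ⟺ RSat M bit₂ (i ◂ b′ ◂ b ◂ ρ)
        in₂ i = ⟺-trans (Bit⟺bitR i b′) (⟺-sym (bit₂-sat M ρ i b′ b))
        same : SameBits a b b′
        same i l = (λ x → proj₂ (in₂ i) (h i (proj₁ l′) (proj₂ l′) (proj₁ (in₁ i) x))) ,
                   (λ x → proj₂ (in₁ i) (h′ i (proj₁ l′) (proj₂ l′) (proj₁ (in₂ i) x)))
          where
          l′ : M ⊨ i < a
          l′ = ⊨<-intro l

      -- Uniqueness of binary codes holds in M for a and 2^a and is expressed by the single formula
      -- `ext`, so elementarity gives it for all numbers of N below 2^a, new ones included.
      ext-N : ∀ a b b′ → N ⊨ b < emb f (exp a) → N ⊨ b′ < emb f (exp a) →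
              (∀ i → N ⊨ i < emb f a → BitN i b ⟺ BitN i b′) → b ≡ b′
      ext-N a b b′ (p , p′) (q , q′) h =
        proj₁ (elem-raw f ext (a ◂ exp a ◂ en)) (ext-M a) b b′ p p′ q q′
          (λ i l≤ l≢ x → proj₂ (out₂ i) (proj₁ (h i (l≤ , l≢)) (proj₁ (out₁ i) x)))
          (λ i l≤ l≢ x → proj₂ (out₁ i) (proj₂ (h i (l≤ , l≢)) (proj₁ (out₂ i) x)))
        where
        ρ : ℕ → Carrier N
        ρ = emb f ∘ (a ◂ exp a ◂ en)
        out₁ : ∀ i → RSat N bit₁ (i ◂ b′ ◂ b ◂ ρ) ⟺ BitN i b
        out₁ i = bit₁-sat N ρ i b′ b
        out₂ : ∀ i → RSat N bit₂ (i ◂ b′ ◂ b ◂ ρ) ⟺ BitN i b′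
        out₂ i = bit₂-sat N ρ i b′ b

    bits-coded : SameCod f J → ∀ b → CodM M J (λ i → BitN (emb f i) b)
    bits-coded cod b = proj₁ (cod (λ i → BitN (emb f i) b)) (suc k , scoped (suc (suc k)) bitR , ρ , sat)
      where
      k : ℕ
      k = bound bitR
      ρ : Fin (suc k) → Carrier N
      ρ = b ∷ (emb f ∘ en ∘ toℕ)
      sat : ∀ i → J i → BitN (emb f i) b ⟺ Sat N (scoped (suc (suc k)) bitR) (emb f i ∷ ρ)
      sat i _ = ⟺-sym (scoped-sat N (suc (suc k)) bitR {emb f i ∷ ρ} {emb f i ◂ b ◂ (emb f ∘ en)}
        (ℕₚ.m≤n⇒m≤1+n (ℕₚ.n≤1+n k)) (λ { zero → refl ; (suc zero) → refl ; (suc (suc j)) → refl }))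

    below-exp-in-M : GcisIs f J → ∀ a → J a → ∀ b → N ⊨ b < emb f (exp a) →
      CodM M J (λ i → BitN (emb f i) b) → Σ[ c ∈ C ] emb f c ≡ b
    below-exp-in-M gcis a Ja b b< (n , φ , ρ , sat) =
      let c , c<exp , h = code-exists (Sat-params-Def₁ φ ρ) a
          c≤ , c≢ = ⊨<-intro c<exp
          same : ∀ i′ → i′ < a → BitN (emb f i′) (emb f c) ⟺ BitN (emb f i′) b
          same i′ l = ⟺-trans (⟺-sym (Bit⟺BitN i′ c))
            (⟺-trans (⟺-sym (h i′ l)) (⟺-sym (sat i′ (J-down (<⇒≤ l) Ja))))
      in c , ext-N a (emb f c) b (proj₁ emb-≤ c≤ , λ e → c≢ (emb-injective e)) b<
        -- Since a is in J, every position of N below a comes from M, so agreement of the digits at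
        -- positions of M is full agreement.
        λ i (p , q) → let i′ , e = proj₁ (gcis a) Ja i p in
          subst (λ i → BitN i (emb f c) ⟺ BitN i b) e (same i′ (⊨<-elim
            ( proj₂ emb-≤ (subst (λ i → Structure._≤_ N i (emb f a)) (sym e) p)
            , λ e′ → q (trans (sym e) (cong (emb f) e′)))))

    expClosed-of-extension : GcisIs f J → SameCod f J → ExpClosed M J
    expClosed-of-extension gcis cod a Ja = exp a , Exp-exists a , proj₂ (gcis (exp a)) in-M
      where
      in-M : ∀ b → Structure._≤_ N b (emb f (exp a)) → Σ[ c ∈ C ] emb f c ≡ b
      in-M b b≤ with em {b ≡ emb f (exp a)}
      ... | yes p = exp a , sym p
      ... | no b≢ = below-exp-in-M gcis a Ja b (b≤ , b≢) (bits-coded cod b)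

-- Large sets and the descending chain

module Extension (em : ExcludedMiddle 0ℓ) (M : Structure) (pa : IsPA M)
                 (en : ℕ → Carrier M) (surj : ∀ m → Σ[ k ∈ ℕ ] en k ≡ m)
                 (J : Pred M) (cut : IsCut M J) (expClosed : ExpClosed M J) where

  open Cuts em M pa en surj J cut public

  J-exp : ∀ {a} → J a → J (exp a)
  J-exp {a} j = let y , p , Jy = expClosed a j in subst J (Exp-unique p) Jy

  J-double : ∀ {a} → J a → J (a + a)
  J-double {a} j = J-down (≤-trans (+-mono-≤ (<⇒≤ (n<exp a)) (<⇒≤ (n<exp a)))
                                   (≤-reflexive (sym (exp-suc a)))) (J-exp (J-suc j))

  -- For a in J the product is 2^(a+a), which is again in J and hence below e; overspill provides
  -- such an a outside J.
  small-exponent : ∀ {e} → ¬ J e → Σ[ a ∈ C ] ((¬ J a) × exp a * exp a < e)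
  small-exponent {e} n = overspill ⟨ definable (expᶠ v0 *ᶠ expᶠ v0 <ᶠ con e) ⟩
    (λ a j → J<∉J (subst J (exp-+ a a) (J-exp (J-double j))) n)

  exp∉J : ∀ {a} → ¬ J a → ¬ J (exp a)
  exp∉J n = ∉J-up n (<⇒≤ (n<exp _))

  -- A condition stands for the set of the values of seq below size.
  record Condition : Set where
    field
      size    : C
      size∉J  : ¬ J size
      seq     : C → C
      seq-def : Fun₁ seq
      seq-inj : InjectiveBelow seq size

  open Condition public

  infix 4 _∈_ _⊑_
  _∈_ : C → Condition → Set
  x ∈ σ = Σ[ j ∈ C ] (j < size σ × seq σ j ≡ x)

  _⊑_ : Condition → Condition → Set
  τ ⊑ σ = ∀ x → x ∈ τ → x ∈ σ

  thin : ∀ σ {k} → ¬ J k → Selection (size σ) k → Condition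
  thin σ {k} n s = record
    { size = k ; size∉J = n ; seq = λ j → seq σ (at s j)
    ; seq-def = ⟨ definableₜ (fun₁ (seq-def σ) (fun₁ (at-def s) v0)) ⟩
    ; seq-inj = λ i j p q h → at-inj s i j p q (seq-inj σ _ _ (at< s i p) (at< s j q) h) }

  thin-⊑ : ∀ σ {k} (n : ¬ J k) (s : Selection (size σ) k) → thin σ n s ⊑ σ
  thin-⊑ σ n s x (j , l , e) = at s j , at< s j l , e

  Constant Injective : (C → C) → Condition → Set
  Constant f σ = Σ[ v ∈ C ] (∀ x → x ∈ σ → f x ≡ v)
  Injective f σ = ∀ x y → x ∈ σ → y ∈ σ → f x ≡ f y → x ≡ y

  Above : (C → C) → Condition → Set
  Above f σ = Σ[ r ∈ C ] ((¬ J r) × (∀ x → x ∈ σ → r ≤ f x))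

  Uniform : (C → C → Set) → Condition → Set
  Uniform φ σ = Σ[ a ∈ C ] ((¬ J a) × Σ[ b ∈ C ] (∀ x → x ∈ σ → ∀ y → y < a → φ y x ⟺ Bit y b))

  thin-constant-or-injective : ∀ {f} → Fun₁ f → ∀ σ →
    Σ[ τ ∈ Condition ] (τ ⊑ σ × (Constant f τ ⊎ Injective f τ))
  thin-constant-or-injective {f} fd σ =
    let a , n , l = small-exponent (size∉J σ)
        s , h = constant-or-injective {λ j → f (seq σ j)} ⟨ definableₜ (fun₁ fd (fun₁ (seq-def σ) v0)) ⟩ l
    in thin σ (exp∉J n) s , thin-⊑ σ (exp∉J n) s , cases (exp∉J n) s h
    where
    cases : ∀ {k} (n : ¬ J k) (s : Selection (size σ) k) →
      ConstantOn (λ j → f (seq σ j)) s ⊎ InjectiveBelow (λ j → f (seq σ (at s j))) k →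
      Constant f (thin σ n s) ⊎ Injective f (thin σ n s)
    cases n s (inj₁ (v , h)) = inj₁ (v , λ { x (j , p , refl) → h j p })
    cases n s (inj₂ h) = inj₂ (λ { x y (i , p , refl) (j , q , refl) e →
      cong (λ j → seq σ (at s j)) (h i j p q e) })

  thin-above : ∀ {f} → Fun₁ f → ∀ σ → Injective f σ → Σ[ τ ∈ Condition ] (τ ⊑ σ × Above f τ)
  thin-above {f} fd σ inj =
    let a , n , l = small-exponent (size∉J σ)
        -- `large-values` is applied with r = a and needs 2 · (a + 1) below the size; both factors
        -- are at most 2^a.
        2≤exp : 𝟏 + 𝟏 ≤ exp a
        2≤exp = ≤-trans (suc-mono-≤ (≤-trans (≤-reflexive (sym (+-identityˡ 𝟏))) (J<∉J zero∈ n))) (n<exp a)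
        s , h = large-values {λ j → f (seq σ j)} ⟨ definableₜ (fun₁ fd (fun₁ (seq-def σ) v0)) ⟩
          (λ i j p q e → seq-inj σ i j p q (inj _ _ (i , p , refl) (j , q , refl) e))
          (≤-<-trans (*-mono-≤ 2≤exp (n<exp a)) l)
        n′ : ¬ J (a + 𝟏)
        n′ = ∉J-up n (≤+ʳ _ _)
    in thin σ n′ s , thin-⊑ σ n′ s , a , n , λ { x (j , p , refl) → h j p }

  thin-uniform : ∀ {φ} → Def₂ φ → ∀ σ → Σ[ τ ∈ Condition ] (τ ⊑ σ × Uniform φ τ)
  thin-uniform {φ} φd σ =
    let a , n , l = small-exponent (size∉J σ)
        s , b , h = uniform-below {λ y j → φ y (seq σ j)} ⟨ definable (rel₂ φd v0 (fun₁ (seq-def σ) v1)) ⟩ l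
    in thin σ (exp∉J n) s , thin-⊑ σ (exp∉J n) s , a , n , b , λ { x (j , p , refl) y q → h j p y q }

  truncate : ∀ c → ¬ J c → ∀ σ → Σ[ τ ∈ Condition ] (τ ⊑ σ × size τ ≤ c)
  truncate c n σ with ≤-<-connex c (size σ)
  ... | inj₂ l = σ , (λ _ h → h) , <⇒≤ l
  ... | inj₁ l = thin σ n s , thin-⊑ σ n s , ≤-refl
    where
    s : Selection (size σ) c
    s = record { at = λ j → j ; at-def = ⟨ definableₜ v0 ⟩ ; at< = λ j p → <-≤-trans p l
               ; at-inj = λ _ _ _ _ e → e }

  holds : ℕ → C → C → Set
  holds n y x = RSat M (formula n) (y ◂ x ◂ en)

  holds-Def : ∀ n → Def₂ (holds n)
  holds-Def n = ⟨ formula n , (λ v → ⟺-refl) ⟩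

  fn : ℕ → C → C
  fn n x = μ (λ y → holds n y x)

  fn-Fun₁ : ∀ n → Fun₁ (fn n)
  fn-Fun₁ n = μ-Fun₁ (holds-Def n)

  -- A single index n is read as the name of a function, of a relation and of an element of M, so
  -- one chain of type ω meets all requirements. Injectivity serves minimality and the inclusion of
  -- J in the gcis, the lower bound keeps J from being filled, `uniform` gives the coded sets and
  -- the ultrafilter property, and `small` bounds the gcis from above.
  record Decides (n : ℕ) (σ : Condition) : Set where
    field
      constant-or-inj : Constant (fn n) σ ⊎ Injective (fn n) σ
      constant-or-above      : Constant (fn n) σ ⊎ Above (fn n) σ
      uniform                : Uniform (holds n) σ
      small                  : ¬ J (en n) → size σ ≤ en n

  open Decides public

  Constant-⊑ : ∀ {f} σ τ → τ ⊑ σ → Constant f σ → Constant f τ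
  Constant-⊑ σ τ s (v , h) = v , λ x p → h x (s x p)

  opaque
    -- The first three properties pass to smaller conditions and can be secured one after another;
    -- the lower bound is obtained from injectivity, and the truncation is done last.
    decide-step : ∀ n σ → Σ[ τ ∈ Condition ] (τ ⊑ σ × Decides n τ)
    decide-step n σ =
      let σ₁ , s₁ , p₁ = thin-constant-or-injective (fn-Fun₁ n) σ
          σ₂ , s₂ , p₂ = above σ₁ p₁
          σ₃ , s₃ , a , a∉J , b , p₃ = thin-uniform (holds-Def n) σ₂
          σ₄ , s₄ , p₄ = trunc σ₃
      in σ₄ , (λ x h → s₁ x (s₂ x (s₃ x (s₄ x h)))) , record
        { constant-or-inj = ci σ₁ σ₄ p₁ (λ x h → s₂ x (s₃ x (s₄ x h)))
        ; constant-or-above = ca σ₂ σ₄ p₂ (λ x h → s₃ x (s₄ x h))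
        ; uniform = a , a∉J , b , (λ x h → p₃ x (s₄ x h))
        ; small = p₄ }
      where
      f : C → C
      f = fn n
      above : ∀ σ → Constant f σ ⊎ Injective f σ → Σ[ τ ∈ Condition ] (τ ⊑ σ × (Constant f τ ⊎ Above f τ))
      above σ (inj₁ c) = σ , (λ _ h → h) , inj₁ c
      above σ (inj₂ i) = let τ , s , p = thin-above (fn-Fun₁ n) σ i in τ , s , inj₂ p
      trunc : ∀ σ → Σ[ τ ∈ Condition ] (τ ⊑ σ × (¬ J (en n) → size τ ≤ en n))
      trunc σ with em {J (en n)}
      ... | yes j = σ , (λ _ h → h) , λ ¬j → ⊥-elim (¬j j)
      ... | no ¬j = let τ , s , p = truncate (en n) ¬j σ in τ , s , λ _ → p
      ci : ∀ σ τ → Constant f σ ⊎ Injective f σ → τ ⊑ σ → Constant f τ ⊎ Injective f τ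
      ci σ τ (inj₁ c) s = inj₁ (Constant-⊑ σ τ s c)
      ci σ τ (inj₂ i) s = inj₂ (λ x y p q → i x y (s x p) (s y q))
      ca : ∀ σ τ → Constant f σ ⊎ Above f σ → τ ⊑ σ → Constant f τ ⊎ Above f τ
      ca σ τ (inj₁ c) s = inj₁ (Constant-⊑ σ τ s c)
      ca σ τ (inj₂ (r , n , h)) s = inj₂ (r , n , λ x p → h x (s x p))

  stage : ℕ → Condition
  stage zero = record
    { size = proj₁ ≠M ; size∉J = proj₂ ≠M ; seq = λ j → j ; seq-def = ⟨ definableₜ v0 ⟩
    ; seq-inj = λ _ _ _ _ e → e }
  stage (suc n) = proj₁ (decide-step n (stage n))

  stage-decides : ∀ n → Decides n (stage (suc n))
  stage-decides n = proj₂ (proj₂ (decide-step n (stage n)))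

  stage-⊑ : ∀ k m → stage (k ℕ.+ m) ⊑ stage m
  stage-⊑ zero    m x h = h
  stage-⊑ (suc k) m x h =
    stage-⊑ k m x (proj₁ (proj₂ (decide-step (k ℕ.+ m) (stage (k ℕ.+ m)))) x h)

  stage-antitone : ∀ {m n} → m ℕ.≤ n → stage n ⊑ stage m
  stage-antitone {m} {n} p = subst (λ k → stage k ⊑ stage m) (ℕₚ.m∸n+n≡m p) (stage-⊑ (n ℕ.∸ m) m)

  -- The ultrafilter generated by the stages

  Eventually : (C → Set) → Set
  Eventually P = Σ[ n ∈ ℕ ] (∀ x → x ∈ stage n → P x)

  Ev-later : ∀ {P} ((n , _) : Eventually P) {m} → n ℕ.≤ m → ∀ x → x ∈ stage m → P x
  Ev-later (n , h) p x q = h x (stage-antitone p x q)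

  Ev-map : ∀ {P Q} → (∀ x → P x → Q x) → Eventually P → Eventually Q
  Ev-map f (n , h) = n , λ x p → f x (h x p)

  Ev-× : ∀ {P Q} → Eventually P → Eventually Q → Eventually (λ x → P x × Q x)
  Ev-× {P} {Q} p q = proj₁ p ⊔ proj₁ q ,
    λ x h → Ev-later {P} p (ℕₚ.m≤m⊔n _ _) x h , Ev-later {Q} q (ℕₚ.m≤n⊔m (proj₁ p) _) x h

  Ev-map₂ : ∀ {P Q R} → (∀ x → P x → Q x → R x) → Eventually P → Eventually Q → Eventually R
  Ev-map₂ {P} {Q} f p q = Ev-map (λ x (a , b) → f x a b) (Ev-× {P} {Q} p q)

  Ev-pure : ∀ {P} → (∀ x → P x) → Eventually P
  Ev-pure h = 0 , λ x _ → h x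

  Ev-Fin : ∀ {n} {P : Fin n → C → Set} → (∀ i → Eventually (P i)) → Eventually (λ x → ∀ i → P i x)
  Ev-Fin {zero}  h = Ev-pure (λ x ())
  Ev-Fin {suc n} {P} h = Ev-map₂ {P zero} (λ { x p q zero → p ; x p q (suc i) → q i })
    (h zero) (Ev-Fin (λ i → h (suc i)))

  size>0 : ∀ σ → 𝟎 < size σ
  size>0 σ = J<∉J zero∈ (size∉J σ)

  Ev-witness : ∀ {P} → Eventually P → Σ[ x ∈ C ] P x
  Ev-witness (n , h) = seq (stage n) 𝟎 , h _ (𝟎 , size>0 (stage n) , refl)

  Ev-not-constant : ∀ c → ¬ Eventually (λ x → x ≡ c)
  Ev-not-constant c (n , h) = succ≢0 𝟎 (sym (seq-inj (stage n) 𝟎 (𝟎 + 𝟏) (size>0 (stage n)) l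
      (trans (h _ (𝟎 , size>0 (stage n) , refl)) (sym (h _ (𝟎 + 𝟏 , l , refl))))))
    where
    l : 𝟎 + 𝟏 < size (stage n)
    l = J<∉J (J-suc zero∈) (size∉J (stage n))

  number : ∀ {Q} → Def₂ Q → Σ[ n ∈ ℕ ] (∀ y x → Q y x ⟺ holds n y x)
  number ⟨ φ , φ-sat ⟩ = let n , e = formula-surjective φ in
    n , λ y x → subst (λ ψ → _ ⟺ RSat M ψ (y ◂ x ◂ en)) (sym e) (φ-sat (y ∷ x ∷ []))

  name : ∀ {g} → Fun₁ g → Σ[ n ∈ ℕ ] (∀ x → fn n x ≡ g x)
  name {g} d = let n , h = number {λ y x → y ≡ g x} ⟨ definable (v0 ≈ᶠ fun₁ d v1) ⟩ in
    n , λ x → μ-≡ (Least-of-unique (proj₁ (h (g x) x) refl) (λ y q → proj₂ (h y x) q))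

  -- View P as a relation φ(y, x) that does not depend on y. `uniform` makes it independent of x on
  -- a stage for all y < a, and y = 𝟎 is below a; the answer is digit 0 of b.
  Ev-decide : ∀ {P} → Def₁ P → Eventually P ⊎ Eventually (λ x → ¬ P x)
  Ev-decide {P} d with number {λ y x → P x} ⟨ definable (rel₁ d v1) ⟩
  ... | n , h with uniform (stage-decides n)
  ... | a , a∉J , b , u with em {Bit 𝟎 b}
  ... | yes q = inj₁ (suc n , λ x p → proj₂ (h 𝟎 x) (proj₂ (u x p 𝟎 (J<∉J zero∈ a∉J)) q))
  ... | no ¬q = inj₂ (suc n , λ x p r → ¬q (proj₁ (u x p 𝟎 (J<∉J zero∈ a∉J)) (proj₁ (h 𝟎 x) r)))

  leastℕ : (P : ℕ → Set) → ∀ n → P n → Σ[ m ∈ ℕ ] (P m × (∀ k → P k → m ℕ.≤ k))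
  leastℕ P n p with search (suc n)
    where
    search : ∀ n → (Σ[ m ∈ ℕ ] (P m × (∀ k → P k → m ℕ.≤ k))) ⊎ (∀ k → k ℕ.< n → ¬ P k)
    search zero = inj₂ (λ k ())
    search (suc n) with search n
    ... | inj₁ r = inj₁ r
    ... | inj₂ h with em {P n}
    ... | yes p = inj₁ (n , p , λ k q → ℕₚ.≮⇒≥ (λ l → h k l q))
    ... | no ¬p = inj₂ λ k l q → [ (λ l′ → h k l′ q) , (λ { refl → ¬p q }) ]′ (ℕₚ.m≤n⇒m<n∨m≡n (ℕ.s≤s⁻¹ l))
  ... | inj₁ r = r
  ... | inj₂ h = ⊥-elim (h n (ℕₚ.n<1+n n) p)

  -- The ultrapower and Łoś's theorem

  _~_ : ℕ → ℕ → Set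
  m ~ n = Eventually (λ x → fn m x ≡ fn n x)

  ~-trans : ∀ {k m n} → k ~ m → m ~ n → k ~ n
  ~-trans {k} {m} {n} = Ev-map₂ {λ x → fn k x ≡ fn m x} {λ x → fn m x ≡ fn n x} (λ x → trans)

  ~-sym : ∀ {m n} → m ~ n → n ~ m
  ~-sym = Ev-map (λ x → sym)

  -- The elements of the ultrapower are the least names in their classes, which makes equality of
  -- elements propositional equality.
  opaque
    norm : ℕ → ℕ
    norm n = proj₁ (leastℕ (_~ n) n (Ev-pure (λ x → refl)))

    norm-~ : ∀ n → norm n ~ n
    norm-~ n = proj₁ (proj₂ (leastℕ (_~ n) n (Ev-pure (λ x → refl))))

    norm-cong : ∀ {m n} → m ~ n → norm m ≡ norm n
    norm-cong {m} {n} p = ℕₚ.≤-antisym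
      (proj₂ (proj₂ (leastℕ (_~ m) m (Ev-pure (λ x → refl)))) (norm n)
        (~-trans {norm n} {n} {m} (norm-~ n) (~-sym {m} {n} p)))
      (proj₂ (proj₂ (leastℕ (_~ n) n (Ev-pure (λ x → refl)))) (norm m)
        (~-trans {norm m} {m} {n} (norm-~ m) p))

  |N| : Set
  |N| = Σ[ n ∈ ℕ ] norm n ≡ n

  val : |N| → C → C
  val a = fn (proj₁ a)

  val-Fun₁ : ∀ a → Fun₁ (val a)
  val-Fun₁ a = fn-Fun₁ (proj₁ a)

  |N|-≡ : ∀ {a b : |N|} → proj₁ a ≡ proj₁ b → a ≡ b
  |N|-≡ {n , p} {.n , q} refl = cong (n ,_) (ℕₚ.≡-irrelevant p q)

  val-injective : ∀ a b → Eventually (λ x → val a x ≡ val b x) → a ≡ b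
  val-injective (m , p) (n , q) e = |N|-≡ (trans (sym p) (trans (norm-cong {m} {n} e) q))

  elt : ∀ {g} → Fun₁ g → |N|
  elt d = norm (proj₁ (name d)) , norm-cong {norm (proj₁ (name d))} {proj₁ (name d)} (norm-~ _)

  val-elt : ∀ {g} (d : Fun₁ g) → Eventually (λ x → val (elt d) x ≡ g x)
  val-elt d = Ev-map (λ x p → trans p (proj₂ (name d) x)) (norm-~ (proj₁ (name d)))

  plus-def : ∀ a b → Fun₁ (λ x → val a x + val b x)
  plus-def a b = ⟨ definableₜ (fun₁ (val-Fun₁ a) v0 +ᶠ fun₁ (val-Fun₁ b) v0) ⟩

  times-def : ∀ a b → Fun₁ (λ x → val a x * val b x)
  times-def a b = ⟨ definableₜ (fun₁ (val-Fun₁ a) v0 *ᶠ fun₁ (val-Fun₁ b) v0) ⟩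

  const-def : ∀ c → Fun₁ (λ _ → c)
  const-def c = ⟨ definableₜ (con c) ⟩

  N : Structure
  N = record
    { Carrier = |N|
    ; 𝟎 = elt (const-def 𝟎)
    ; 𝟏 = elt (const-def 𝟏)
    ; _+_ = λ a b → elt (plus-def a b)
    ; _*_ = λ a b → elt (times-def a b)
    ; _≤_ = λ a b → Eventually (λ x → val a x ≤ val b x)
    }

  infix 30 _⟨_⟩ᵉ
  _⟨_⟩ᵉ : ∀ {n} → (Fin n → |N|) → C → Fin n → C
  (ρ ⟨ x ⟩ᵉ) i = val (ρ i) x

  eval-val : ∀ {n} (t : Term n) ρ → Eventually (λ x → val (eval N t ρ) x ≡ eval M t (ρ ⟨ x ⟩ᵉ))
  eval-val (var i)  ρ = Ev-pure (λ x → refl)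
  eval-val `0       ρ = val-elt (const-def 𝟎)
  eval-val `1       ρ = val-elt (const-def 𝟏)
  eval-val (s `+ t) ρ = Ev-map₂ (λ x p (q , r) → trans p (cong₂ _+_ q r))
    (val-elt (plus-def (eval N s ρ) (eval N t ρ))) (Ev-× (eval-val s ρ) (eval-val t ρ))
  eval-val (s `* t) ρ = Ev-map₂ (λ x p (q , r) → trans p (cong₂ _*_ q r))
    (val-elt (times-def (eval N s ρ) (eval N t ρ))) (Ev-× (eval-val s ρ) (eval-val t ρ))

  -- Pointwise equal environments need not be equal as functions, so both are compared with one raw
  -- environment.
  Sat-cong : ∀ {K : Structure} {n} (φ : Formula n) {ρ ρ′ : Fin n → Carrier K} → (∀ i → ρ i ≡ ρ′ i) →
             Sat K φ ρ ⟺ Sat K φ ρ′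
  Sat-cong {K} φ {ρ} {ρ′} h =
    ⟺-trans (raw-sat K φ {toℕ} {ρ ▷ (λ _ → Structure.𝟎 K)} (λ i → sym (▷-var ρ _ i)))
      (⟺-sym (raw-sat K φ {toℕ} {ρ ▷ (λ _ → Structure.𝟎 K)}
        (λ i → trans (sym (h i)) (sym (▷-var ρ _ i)))))

  Satᶠ : ∀ {k n} → Formula k → (Fin k → Tm n) → Fm n
  Satᶠ φ ts = atom (Sat M φ) (Sat-Def φ) ts

  valᶠ : ∀ {k n} → (Fin k → |N|) → Tm n → Fin k → Tm n
  valᶠ ρ t i = fun₁ (val-Fun₁ (ρ i)) t

  Sat-∷ : ∀ {n} (φ : Formula (suc n)) a ρ x →
          Sat M φ ((a ∷ ρ) ⟨ x ⟩ᵉ) ⟺ Sat M φ (val a x ∷ ρ ⟨ x ⟩ᵉ)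
  Sat-∷ φ a ρ x = Sat-cong φ (λ { zero → refl ; (suc i) → refl })

  Sat-∷-Def₂ : ∀ {n} (φ : Formula (suc n)) ρ → Def₂ (λ y x → Sat M φ (y ∷ ρ ⟨ x ⟩ᵉ))
  Sat-∷-Def₂ φ ρ = ⟨ Def-resp (λ v → Sat-cong φ (λ { zero → refl ; (suc i) → refl }))
                              (definable (Satᶠ φ (v0 ∷ valᶠ ρ v1))) ⟩

  -- Implication uses that definable sets are decided by the chain, and the quantifier uses that M
  -- has definable Skolem functions.
  Łoś : ∀ {n} (φ : Formula n) ρ → Sat N φ ρ ⟺ Eventually (λ x → Sat M φ (ρ ⟨ x ⟩ᵉ))
  Łoś (s ≐ t) ρ =
    (λ p → Ev-map₂ (λ x q r → trans (sym q) (trans (cong (λ a → val a x) p) r))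
      (eval-val s ρ) (eval-val t ρ)) ,
    (λ p → val-injective _ _ (Ev-map₂ (λ x p (q , r) → trans q (trans p (sym r))) p
      (Ev-× (eval-val s ρ) (eval-val t ρ))))
  Łoś (s ≼ t) ρ =
    (λ p → Ev-map₂ (λ x p (q , r) → subst₂ _≤_ q r p) p (Ev-× (eval-val s ρ) (eval-val t ρ))) ,
    (λ p → Ev-map₂ (λ x p (q , r) → subst₂ _≤_ (sym q) (sym r) p) p (Ev-× (eval-val s ρ) (eval-val t ρ)))
  Łoś ⊥' ρ = (λ ()) , (λ p → proj₂ (Ev-witness p))
  Łoś (φ ⇒ ψ) ρ = to , from
    where
    to : (Sat N φ ρ → Sat N ψ ρ) → Eventually (λ x → Sat M (φ ⇒ ψ) (ρ ⟨ x ⟩ᵉ))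
    to h with Ev-decide {λ x → Sat M φ (ρ ⟨ x ⟩ᵉ)} ⟨ definable (Satᶠ φ (valᶠ ρ v0)) ⟩
    ... | inj₁ p = Ev-map (λ x q _ → q) (proj₁ (Łoś ψ ρ) (h (proj₂ (Łoś φ ρ) p)))
    ... | inj₂ p = Ev-map (λ x n q → ⊥-elim (n q)) p
    from : Eventually (λ x → Sat M (φ ⇒ ψ) (ρ ⟨ x ⟩ᵉ)) → Sat N φ ρ → Sat N ψ ρ
    from p q = proj₂ (Łoś ψ ρ) (Ev-map₂ (λ x f a → f a) p (proj₁ (Łoś φ ρ) q))
  Łoś (∀' φ) ρ = to , from
    where
    Fails : C → C → Set
    Fails y x = ¬ Sat M φ (y ∷ ρ ⟨ x ⟩ᵉ)
    Fails-def : Def₂ Fails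
    Fails-def = ⟨ definable (¬ᶠ rel₂ (Sat-∷-Def₂ φ ρ) v0 v1) ⟩
    Fails-def₁ : ∀ x → Def₁ (λ y → Fails y x)
    Fails-def₁ x = ⟨ definable (rel₂ Fails-def v0 (con x)) ⟩
    -- The least counterexample at x, wherever there is one; if counterexamples exist eventually,
    -- this element refutes the hypothesis in N.
    skolem : |N|
    skolem = elt (μ-Fun₁ Fails-def)
    to : (∀ a → Sat N φ (a ∷ ρ)) → Eventually (λ x → Sat M (∀' φ) (ρ ⟨ x ⟩ᵉ))
    to h with Ev-decide {λ x → ∀ y → ¬ Fails y x} ⟨ definable (∀ᶠ (¬ᶠ rel₂ Fails-def v0 v1)) ⟩
    ... | inj₁ p = Ev-map (λ x q y → by-contradiction (q y)) p
    ... | inj₂ p = ⊥-elim (proj₂ (Ev-witness (Ev-map₂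
        (λ x n (q , e) → n (λ y f → proj₁ (μ-least (Fails-def₁ x) y f)
          (subst (λ y → Sat M φ (y ∷ ρ ⟨ x ⟩ᵉ)) e (proj₁ (Sat-∷ φ skolem ρ x) q))))
        p (Ev-× (proj₁ (Łoś φ (skolem ∷ ρ)) (h skolem)) (val-elt (μ-Fun₁ Fails-def))))))
    from : Eventually (λ x → Sat M (∀' φ) (ρ ⟨ x ⟩ᵉ)) → ∀ a → Sat N φ (a ∷ ρ)
    from p a = proj₂ (Łoś φ (a ∷ ρ)) (Ev-map (λ x h → proj₂ (Sat-∷ φ a ρ x) (h (val a x))) p)

  -- The embedding and the properties of the extension

  ι : C → |N|
  ι c = elt (const-def c)

  val-ι : ∀ c → Eventually (λ x → val (ι c) x ≡ c)
  val-ι c = val-elt (const-def c)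

  ι-elem : ∀ {n} (φ : Formula n) (ρ : Fin n → C) → Sat M φ ρ ⟺ Sat N φ (ι ∘ ρ)
  ι-elem φ ρ = ⟺-trans
    ( (λ p → Ev-map (λ x h → proj₂ (Sat-cong φ h) p) vals)
    , (λ p → proj₂ (Ev-witness (Ev-map₂ (λ x q h → proj₁ (Sat-cong φ h) q) p vals))))
    (⟺-sym (Łoś φ (ι ∘ ρ)))
    where
    vals : Eventually (λ x → ∀ i → ((ι ∘ ρ) ⟨ x ⟩ᵉ) i ≡ ρ i)
    vals = Ev-Fin (λ i → val-ι (ρ i))

  ι-emb : ElemEmb M N
  ι-emb = record { emb = ι ; elem = ι-elem }

  ι-constant : ∀ a {v} → Eventually (λ x → val a x ≡ v) → ι v ≡ a
  ι-constant a {v} p = val-injective (ι v) a (Ev-map₂ (λ x p q → trans p (sym q)) (val-ι v) p)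

  constant-ι : ∀ a {v} → ι v ≡ a → Eventually (λ x → val a x ≡ v)
  constant-ι .(ι v) {v} refl = val-ι v

  ι-Constant : ∀ a → Constant (val a) (stage (suc (proj₁ a))) → Σ[ v ∈ C ] ι v ≡ a
  ι-Constant a (v , h) = v , ι-constant a (suc (proj₁ a) , h)

  ι-≤ : ∀ {a c} → Structure._≤_ N a (ι c) → Eventually (λ x → val a x ≤ c)
  ι-≤ {a} {c} p = Ev-map₂ (λ x p q → subst (val a x ≤_) q p) p (val-ι c)

  ≤-ι : ∀ {a c} → Eventually (λ x → val a x ≤ c) → Structure._≤_ N a (ι c)
  ≤-ι {a} {c} p = Ev-map₂ (λ x p q → subst (val a x ≤_) (sym q) p) p (val-ι c)

  id-Fun₁ : Fun₁ (λ x → x)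
  id-Fun₁ = ⟨ definableₜ v0 ⟩

  proper : Proper ι-emb
  proper = elt id-Fun₁ , λ c e → Ev-not-constant c
    (Ev-map₂ (λ x p q → trans (sym p) q) (val-elt id-Fun₁) (constant-ι _ e))

  -- A function bounded by b in J cannot be injective on a stage, as the pigeonhole principle would
  -- put the size of the stage into J. Hence it is constant there.
  J⊆gcis : ∀ b → J b → ∀ a → Structure._≤_ N a (ι b) → Σ[ c ∈ C ] ι c ≡ a
  J⊆gcis b Jb a a≤ with constant-or-inj (stage-decides (proj₁ a))
  ... | inj₁ c = ι-Constant a c
  ... | inj₂ i = ⊥-elim (size∉J σ (J-down (pigeonhole {λ j → val a (seq σ j)} {size σ} {b + 𝟏}
        ⟨ definableₜ (fun₁ (val-Fun₁ a) (fun₁ (seq-def σ) v0)) ⟩ inj bnd) (J-suc Jb)))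
    where
    low : Eventually (λ x → val a x ≤ b)
    low = ι-≤ {a} a≤
    m n : ℕ
    n = suc (proj₁ a)
    m = proj₁ low ⊔ n
    σ : Condition
    σ = stage m
    inj : InjectiveBelow (λ j → val a (seq σ j)) (size σ)
    inj j j′ p q e = seq-inj σ j j′ p q (i _ _ (sub j p) (sub j′ q) e)
      where
      sub : ∀ j → j < size σ → seq σ j ∈ stage n
      sub j p = stage-antitone (ℕₚ.m≤n⊔m (proj₁ low) n) _ (j , p , refl)
    bnd : ∀ j → j < size σ → val a (seq σ j) < b + 𝟏
    bnd j p = suc-mono-≤ (Ev-later {λ x → val a x ≤ b} low (ℕₚ.m≤m⊔n _ n) _ (j , p , refl))

  -- With g the identity this is the index of a point in the listing of `σ`; with g injective on `σ`
  -- it leads back from the value of g to the point.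
  preimage : Condition → (C → C) → C → C
  preimage σ g u = μ (λ j → j < size σ × g (seq σ j) ≡ u)

  preimage-Fun₁ : ∀ σ {g} → Fun₁ g → Fun₁ (preimage σ g)
  preimage-Fun₁ σ {g} d = μ-Fun₁ {Q = λ j u → j < size σ × g (seq σ j) ≡ u}
    ⟨ definable (v0 <ᶠ con (size σ) ∧ fun₁ d (fun₁ (seq-def σ) v0) ≈ᶠ v1) ⟩

  preimage-spec : ∀ σ {g} → Fun₁ g → ∀ x → x ∈ σ →
    preimage σ g (g x) < size σ × g (seq σ (preimage σ g (g x))) ≡ g x
  preimage-spec σ {g} d x (j , l , e) = proj₁ (μ-least {λ j → j < size σ × g (seq σ j) ≡ g x}
    ⟨ definable (v0 <ᶠ con (size σ) ∧ fun₁ d (fun₁ (seq-def σ) v0) ≈ᶠ con (g x)) ⟩ j (l , cong g e))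

  -- If b is outside J, some stage has size at most b, and the index of the generic point in this
  -- stage is an element of N below b. It is new: the listing recovers the generic point from it,
  -- and that point is not constant.
  gcis⊆J : ∀ b → (∀ a → Structure._≤_ N a (ι b) → Σ[ c ∈ C ] ι c ≡ a) → J b
  gcis⊆J b h with surj b
  ... | n , refl = by-contradiction absurd
    where
    σ : Condition
    σ = stage (suc n)
    index-def : Fun₁ (preimage σ (λ x → x))
    index-def = preimage-Fun₁ σ id-Fun₁
    a : |N|
    a = elt index-def
    inside : Eventually (λ x → x ∈ σ)
    inside = suc n , λ x p → p
    absurd : ¬ J (en n) → ⊥
    absurd ¬j =
      let a≤ : Eventually (λ x → val a x ≤ en n)
          a≤ = Ev-map₂ (λ x p q → ≤-trans (≤-reflexive p)
                 (≤-trans (<⇒≤ (proj₁ (preimage-spec σ id-Fun₁ x q))) (small (stage-decides n) ¬j)))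
                 (val-elt index-def) inside
          c , e = h a (≤-ι {a} a≤)
      in Ev-not-constant (seq σ c) (Ev-map₂
        (λ x (p , r) q → trans (sym (proj₂ (preimage-spec σ id-Fun₁ x q))) (cong (seq σ) (trans (sym p) r)))
        (Ev-× (val-elt index-def) (constant-ι a e)) inside)

  gcis : GcisIs ι-emb J
  gcis b = J⊆gcis b , gcis⊆J b

  Def₁⇒CodM : ∀ {P} → Def₁ P → CodM M J P
  Def₁⇒CodM ⟨ ψ , ψ-sat ⟩ = bound ψ , scoped (suc (bound ψ)) ψ , (en ∘ toℕ) ,
    λ a _ → ⟺-trans (ψ-sat (a ∷ [])) (⟺-sym (scoped-sat M (suc (bound ψ)) ψ
      {a ∷ (en ∘ toℕ)} {a ◂ en} (ℕₚ.n≤1+n _) (λ { zero → refl ; (suc i) → refl })))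

  -- By Łoś's theorem X is the set of y in J for which φ(y, x) eventually holds. On a suitable stage
  -- φ(y, x) agrees with digit y of one fixed b for all y below some a outside J, in particular for
  -- all y in J.
  cod-N⊆M : ∀ X → CodN ι-emb J X → CodM M J X
  cod-N⊆M X (n , φ , ρ , h) =
    let m , num = number (Sat-∷-Def₂ φ ρ)
        a , a∉J , b , u = uniform (stage-decides m)
        k , ψ , ρ′ , cod = Def₁⇒CodM {λ y → Bit y b} ⟨ definable (Bitᶠ v0 (con b)) ⟩
        shift : ∀ y → Eventually (λ x → Sat M φ ((ι y ∷ ρ) ⟨ x ⟩ᵉ)) ⟺
                      Eventually (λ x → Sat M φ (y ∷ ρ ⟨ x ⟩ᵉ))
        shift y =
          (λ p → Ev-map₂ (λ x p e → subst (λ y → Sat M φ (y ∷ ρ ⟨ x ⟩ᵉ)) e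
                   (proj₁ (Sat-∷ φ (ι y) ρ x) p)) p (val-ι y)) ,
          (λ p → Ev-map₂ (λ x p e → proj₂ (Sat-∷ φ (ι y) ρ x)
                   (subst (λ y → Sat M φ (y ∷ ρ ⟨ x ⟩ᵉ)) (sym e) p)) p (val-ι y))
        coded : ∀ y → J y → Eventually (λ x → Sat M φ (y ∷ ρ ⟨ x ⟩ᵉ)) ⟺ Bit y b
        coded y Jy =
          (λ p → proj₂ (Ev-witness (Ev-map₂ (λ x p q → proj₁ (u x q y (J<∉J Jy a∉J)) (proj₁ (num y x) p)) p
                   (suc m , λ x q → q)))) ,
          (λ p → suc m , λ x q → proj₂ (num y x) (proj₂ (u x q y (J<∉J Jy a∉J)) p))
    in k , ψ , ρ′ , λ y Jy → ⟺-trans (h y Jy) (⟺-trans (Łoś φ (ι y ∷ ρ))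
         (⟺-trans (shift y) (⟺-trans (coded y Jy) (cod y Jy))))

  cod-M⊆N : ∀ X → CodM M J X → CodN ι-emb J X
  cod-M⊆N X (n , φ , ρ , h) = n , φ , ι ∘ ρ , λ a Ja → ⟺-trans (h a Ja)
    (⟺-trans (ι-elem φ (a ∷ ρ)) (Sat-cong φ (λ { zero → refl ; (suc i) → refl })))

  same-cod : SameCod ι-emb J
  same-cod X = cod-N⊆M X , cod-M⊆N X

  -- An eventually constant element lies in M, hence on one side of the cut. Any other element is
  -- eventually at least some r outside J, so it is not below all elements outside J.
  not-fills : ¬ Fills ι-emb J
  not-fills (a , above , below) with constant-or-above (stage-decides (proj₁ a))
  ... | inj₁ c with ι-Constant a c
  ... | v , refl with em {J v}
  ... | yes j = proj₂ (above v j) refl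
  ... | no ¬j = proj₂ (below v ¬j) refl
  not-fills (a , above , below) | inj₂ (r , r∉J , h) = proj₂ (below r r∉J)
    (val-injective a (ι r) (Ev-map₂ (λ x (p , q) e → trans (≤-antisym p q) (sym e))
      (Ev-× (ι-≤ {a} (proj₁ (below r r∉J))) (suc (proj₁ a) , h)) (val-ι r)))

  -- The values of `ι` are only eventually constant, each from its own stage on; as `ψ` mentions
  -- finitely many parameters, one stage works for all of them.
  Łoś-raw : ∀ ψ b a → RSat N ψ (b ◂ a ◂ (ι ∘ en)) ⟺ Eventually (λ x → RSat M ψ (val b x ◂ val a x ◂ en))
  Łoś-raw ψ b a = ⟺-trans (⟺-sym (scoped-sat N k ψ {ρ ∘ toℕ} {ρ} ℕₚ.≤-refl (λ _ → refl)))
    (⟺-trans (Łoś (scoped k ψ) (ρ ∘ toℕ))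
      ( (λ p → Ev-map₂ (λ x p h → proj₁ (sat x h) p) p vals)
      , (λ p → Ev-map₂ (λ x p h → proj₂ (sat x h) p) p vals)))
    where
    k : ℕ
    k = bound ψ
    ρ : ℕ → |N|
    ρ = b ◂ a ◂ (ι ∘ en)
    vals′ : ∀ i → Eventually (λ x → val (ρ i) x ≡ (val b x ◂ val a x ◂ en) i)
    vals′ 0             = Ev-pure (λ x → refl)
    vals′ 1             = Ev-pure (λ x → refl)
    vals′ (suc (suc i)) = val-ι (en i)
    vals : Eventually (λ x → ∀ i → ((ρ ∘ toℕ) ⟨ x ⟩ᵉ) i ≡ (val b x ◂ val a x ◂ en) (toℕ i))
    vals = Ev-Fin {k} (λ i → vals′ (toℕ i))
    sat : ∀ x → (∀ i → ((ρ ∘ toℕ) ⟨ x ⟩ᵉ) i ≡ (val b x ◂ val a x ◂ en) (toℕ i)) →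
          Sat M (scoped k ψ) ((ρ ∘ toℕ) ⟨ x ⟩ᵉ) ⟺ RSat M ψ (val b x ◂ val a x ◂ en)
    sat x h = scoped-sat M k ψ {(ρ ∘ toℕ) ⟨ x ⟩ᵉ} {val b x ◂ val a x ◂ en} ℕₚ.≤-refl h

  -- An element of N outside M is an injective function of the generic element, so every element of N
  -- is the value at it of a function definable in M.
  generates : ∀ a → (∀ v → ι v ≢ a) → ∀ b → Σ[ G ∈ (C → C) ] Fun₁ G × Eventually (λ x → val b x ≡ G (val a x))
  generates a a∉ b with constant-or-inj (stage-decides (proj₁ a))
  ... | inj₁ c = ⊥-elim (let v , e = ι-Constant a c in a∉ v e)
  ... | inj₂ i = G , Gd , suc (proj₁ a) , λ x p → cong (val b) (sym (inverse x p))
    where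
    σ : Condition
    σ = stage (suc (proj₁ a))
    G : C → C
    G u = val b (seq σ (preimage σ (val a) u))
    Gd : Fun₁ G
    Gd = ⟨ definableₜ (fun₁ (val-Fun₁ b) (fun₁ (seq-def σ) (fun₁ (preimage-Fun₁ σ (val-Fun₁ a)) v0))) ⟩
    inverse : ∀ x → x ∈ σ → seq σ (preimage σ (val a) (val a x)) ≡ x
    inverse x p = let q , r = preimage-spec σ (val-Fun₁ a) x p in i _ x (_ , q , refl) p r

  -- A strictly intermediate K contains some k outside M, and b in N outside K is the value at k of
  -- a function definable in M. Being elementary, K contains that value.
  minimal : Minimal ι-emb
  minimal = proper , λ (K , g , h , (k , k∉) , (b , b∉) , comm) →
    let a = emb h k
        a∉ : ∀ v → ι v ≢ a
        a∉ v e = k∉ v (proj₂ (elem h (var zero ≐ var (suc zero)) (emb g v ∷ k ∷ [])) (trans (comm v) e))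
        G , ⟨ ψ , ψ-sat ⟩ , eq = generates a a∉ b
        graph : ∀ y u → (y ≡ G u) ⟺ RSat M ψ (y ◂ u ◂ en)
        graph y u = ψ-sat (y ∷ u ∷ [])
        -- Totality of G is transferred from M to K, which gives a value y in K; since `ψ` is
        -- functional in M, the image of y has to be b.
        total : RSat M (r∀ (r∃ ψ)) en
        total u = proj₁ (r∃-sat M ψ (u ◂ en)) (G u , proj₁ (graph (G u) u) refl)
        y , yψ = proj₂ (r∃-sat K ψ (k ◂ (emb g ∘ en))) (proj₁ (elem-raw g (r∀ (r∃ ψ)) en) total k)
        hyψ : RSat N ψ (emb h y ◂ a ◂ (ι ∘ en))
        hyψ = proj₁ (RSat-cong N ψ (λ { 0 → refl ; 1 → refl ; (suc (suc i)) → comm (en i) }))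
                (proj₁ (elem-raw h ψ (y ◂ k ◂ (emb g ∘ en))) yψ)
    in b∉ y (val-injective (emb h y) b (Ev-map₂
         (λ x p q → trans (proj₂ (graph _ _) p) (sym q)) (proj₁ (Łoś-raw ψ (emb h y) a) hyψ) eq))

theorem1p2 : (∀ {ℓ : Level} → ExcludedMiddle ℓ) →
  (M : Structure) → IsPA M → Countable M →
  (J : Pred M) → IsCut M J →
    -- (1) ⇒ (2)
    (ExpClosed M J →
       Σ[ N ∈ Structure ] Σ[ f ∈ ElemEmb M N ] (Proper f × GcisIs f J × SameCod f J))
  × -- (2) ⇒ (3)
    ((Σ[ N ∈ Structure ] Σ[ f ∈ ElemEmb M N ] (Proper f × GcisIs f J × SameCod f J)) →
       Σ[ N ∈ Structure ] Σ[ f ∈ ElemEmb M N ]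
         (Minimal f × GcisIs f J × SameCod f J × ¬ Fills f J))
  × -- (3) ⇒ (1)
    ((Σ[ N ∈ Structure ] Σ[ f ∈ ElemEmb M N ]
         (Minimal f × GcisIs f J × SameCod f J × ¬ Fills f J)) →
       ExpClosed M J)
theorem1p2 em M pa (en , surj) J cut =
  -- Exponential closure already yields the extension of (3), so (2) follows by forgetting, and (2)
  -- leads to (3) by way of (1), generally with a different N.
  (λ e → let N , f , minimal , gcis , cod , _ = exp⇒min e in N , f , proj₁ minimal , gcis , cod) ,
  (λ (N , f , _ , gcis , cod) → exp⇒min (Cuts.expClosed-of-extension em M pa en surj J cut f gcis cod)) ,
  (λ (N , f , _ , gcis , cod , _) → Cuts.expClosed-of-extension em M pa en surj J cut f gcis cod)
  where
  exp⇒min : ExpClosed M J → Σ[ N ∈ Structure ] Σ[ f ∈ ElemEmb M N ]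
              (Minimal f × GcisIs f J × SameCod f J × ¬ Fills f J)
  exp⇒min e = E.N , E.ι-emb , E.minimal , E.gcis , E.same-cod , E.not-fills
    where
    module E = Extension em M pa en surj J cut e
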